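{- For a fixed $k \geq 0$, let $\mathcal{S}_n^k$ be the collection of all configurations of $n$ points on a circle such that $n-k$ of the points form a regular $(n-k)$-gon and the remaining $k$ points are placed arbitrarily on the circle. Then $$\max_{\mathcal{P} \in \mathcal{S}_n^k} A(\mathcal{P}) = \Theta(nk).$$
   Context: For a finite set $\mathcal P \subset \mathbb{R}^2$, $A(\mathcal P)$ denotes the number of distinct angles in the open interval $(0,\pi)$ determined by triples of distinct points of $\mathcal P$ (angles of $0$ and $\pi$ are not counted). $f = O(g)$ means there is a constant $C$ with $f(n) \le C g(n)$ for all sufficiently large $n$; $f=\Omega(g)$ means $g = O(f)$; $f=\Theta(g)$ means both $f=O(g)$ and $f=\Omega(g)$.
   Formalization: The case k = 0 is excluded (k ≥ 1 is assumed), since a regular n-gon determines n−2 angles, which is not O(n·0); as k is fixed, the constants in Θ may depend on k. -}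

module Defs where

open import Algebra.Bundles using (CommutativeRing)
open import Data.Fin.Base using (Fin; toℕ)
open import Data.List.Base using (List; length)
import Data.List.Membership.Setoid as Membership
import Data.List.Relation.Unary.Unique.Setoid as Uniqueness
open import Data.Nat.Base as ℕ using (ℕ; suc; _∸_)
open import Data.Nat.DivMod using (_mod_)
open import Data.Product using (Σ; ∃; ∃-syntax; _×_; _,_; proj₁; proj₂)
open import Function.Bundles using (_⇔_)
open import Level using (0ℓ)
open import Relation.Binary.Core using (Rel)
open import Relation.Binary.Structures using (IsStrictTotalOrder)
import Relation.Binary.Construct.StrictToNonStrict as StrictToNonStrict
open import Relation.Binary.PropositionalEquality.Core using (_≡_; _≢_)
open import Relation.Nullary.Negation.Core using (¬_)

-- The real numbers, given by their usual axiomatic characterisation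
-- (unique up to isomorphism): a Dedekind-complete ordered field.
record CompleteOrderedField : Set₁ where
  infix 4 _<_ _≤_
  field
    commutativeRing : CommutativeRing 0ℓ 0ℓ
  open CommutativeRing commutativeRing public
  field
    _<_                : Rel Carrier 0ℓ
    isStrictTotalOrder : IsStrictTotalOrder _≈_ _<_
    0<1                : 0# < 1#
    +-monoˡ-<          : ∀ z {x y} → x < y → x + z < y + z
    *-pos              : ∀ {x y} → 0# < x → 0# < y → 0# < x * y
    inverse            : ∀ x → ¬ (x ≈ 0#) → ∃[ y ] x * y ≈ 1#

  _≤_ : Rel Carrier 0ℓ
  _≤_ = StrictToNonStrict._≤_ _≈_ _<_

  IsUpperBound : (Carrier → Set) → Carrier → Set
  IsUpperBound A b = ∀ x → A x → x ≤ b

  IsSupremum : (Carrier → Set) → Carrier → Set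
  IsSupremum A s = IsUpperBound A s × (∀ b → IsUpperBound A b → s ≤ b)

  field
    complete : (A : Carrier → Set) → ∃ A → ∃ (IsUpperBound A) → ∃ (IsSupremum A)

module Plane (ℝ : CompleteOrderedField) where
  open CompleteOrderedField ℝ

  infix  4 _≈ₚ_
  infixl 6 _-ₚ_
  infixl 7 _·_

  Point : Set
  Point = Carrier × Carrier

  _≈ₚ_ : Rel Point 0ℓ
  (x , y) ≈ₚ (x′ , y′) = (x ≈ x′) × (y ≈ y′)

  _-ₚ_ : Point → Point → Point
  (x , y) -ₚ (x′ , y′) = (x - x′ , y - y′)

  _·_ : Point → Point → Carrier
  (x , y) · (x′ , y′) = x * x′ + y * y′

  cross : Point → Point → Carrier
  cross (x , y) (x′ , y′) = x * y′ - y * x′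

  -- Functions such as the norm, arccos and the angle are given by their
  -- graphs: the relation holds of the value, last argument.

  IsNorm : Point → Carrier → Set
  IsNorm u s = (0# ≤ s) × (s * s ≈ u · u)

  IsDistance : Point → Point → Carrier → Set
  IsDistance p q = IsNorm (q -ₚ p)

  OnUpperUnitSemicircle : Point → Set
  OnUpperUnitSemicircle p = (p · p ≈ 1#) × (0# ≤ proj₂ p)

  -- Polygonal chains inscribed in the upper unit semicircle, running
  -- counterclockwise from (1 , 0) to the first index; the second index is
  -- the length of the chain.
  data InscribedChain : Point → Carrier → Set where
    start  : ∀ {p} → p ≈ₚ (1# , 0#) → InscribedChain p 0#
    extend : ∀ {p q ℓ d} → InscribedChain p ℓ →
             OnUpperUnitSemicircle q → proj₁ q < proj₁ p →
             IsDistance p q d → InscribedChain q (ℓ + d)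

  -- arccos c is the length of the arc of the upper unit semicircle from
  -- (1 , 0) to the point with abscissa c, i.e. the supremum of the lengths
  -- of the inscribed chains.
  IsArccos : Carrier → Carrier → Set
  IsArccos c = IsSupremum (λ ℓ → ∃[ y ] InscribedChain (c , y) ℓ)

  Isπ : Carrier → Set
  Isπ = IsArccos (- 1#)

  -- The value is unique only for nonzero u and v.
  IsCosine : Point → Point → Carrier → Set
  IsCosine u v c = ∃[ s ] ∃[ t ] IsNorm u s × IsNorm v t × (c * (s * t) ≈ u · v)

  -- The angle at q, in radians: arccos of ⟨p-q , r-q⟩ / (|p-q| |r-q|).
  IsAngle : Point → Point → Point → Carrier → Set
  IsAngle p q r θ = ∃[ c ] IsCosine (p -ₚ q) (r -ₚ q) c × IsArccos c θ

  -- A set of n points is an injective family Fin n → Point.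
  Distinct : ∀ {n} → (Fin n → Point) → Set
  Distinct P = ∀ i j → P i ≈ₚ P j → i ≡ j

  DeterminesAngle : ∀ {n} → (Fin n → Point) → Carrier → Set
  DeterminesAngle P θ =
    (∃[ i ] ∃[ j ] ∃[ l ] (i ≢ j) × (j ≢ l) × (i ≢ l) ×
       IsAngle (P i) (P j) (P l) θ) ×
    (0# < θ) × (∃[ π ] Isπ π × (θ < π))

  HasCardinality : (Carrier → Set) → ℕ → Set
  HasCardinality A N =
    Σ (List Carrier) λ xs → Unique xs × (∀ x → (x ∈ xs) ⇔ A x) × (length xs ≡ N)
    where
    open Membership setoid using (_∈_)
    open Uniqueness setoid using (Unique)

  -- A(P) = N
  AngleCount : ∀ {n} → (Fin n → Point) → ℕ → Set
  AngleCount P = HasCardinality (DeterminesAngle P)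

  next : ∀ {m} → Fin m → Fin m
  next {suc m} i = suc (toℕ i) mod suc m

  -- v lists the vertices of a regular m-gon counterclockwise. Convexity says
  -- that all the other vertices lie strictly to the left of each side; in
  -- particular the vertices are distinct when m ≥ 3.
  record IsRegularPolygon {m : ℕ} (v : Fin m → Point) : Set where
    field
      atLeast3    : 3 ℕ.≤ m
      convex      : ∀ i j → j ≢ i → j ≢ next i →
                    0# < cross (v (next i) -ₚ v i) (v j -ₚ v i)
      equilateral : ∃[ s ] ∀ i → IsDistance (v i) (v (next i)) s
      equiangular : ∃[ θ ] ∀ i → IsAngle (v i) (v (next i)) (v (next (next i))) θ

  OnCircle : ∀ {n} → (Fin n → Point) → Set
  OnCircle P = ∃[ centre ] ∃[ r ] (0# < r) × (∀ i → IsDistance centre (P i) r)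

  -- The family 𝒮ₙᵏ. The polygon's vertices being distinct, exactly k of the
  -- n points are left unconstrained.
  record 𝒮 (n k : ℕ) (P : Fin n → Point) : Set where
    field
      distinct : Distinct P
      onCircle : OnCircle P
      polygon  : Σ (Fin (n ∸ k) → Fin n) λ ι → IsRegularPolygon (λ i → P (ι i))

  -- max { A(P) : P ∈ 𝒮ₙᵏ } = N
  IsMaxAngleCount : (n k N : ℕ) → Set
  IsMaxAngleCount n k N =
    (Σ (Fin n → Point) λ P → 𝒮 n k P × AngleCount P N) ×
    (∀ P → 𝒮 n k P → ∀ M → AngleCount P M → M ℕ.≤ N)

-- Asymptotics of functions ℕ → ℕ. Since the values are natural numbers, a
-- real constant may be rounded up to a natural one.
infix 4 _∈O_ _∈Ω_ _∈Θ_

_∈O_ : Rel (ℕ → ℕ) 0ℓ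
f ∈O g = ∃[ C ] ∃[ n₀ ] ∀ n → n₀ ℕ.≤ n → f n ℕ.≤ C ℕ.* g n

_∈Ω_ : Rel (ℕ → ℕ) 0ℓ
f ∈Ω g = g ∈O f

_∈Θ_ : Rel (ℕ → ℕ) 0ℓ
f ∈Θ g = (f ∈O g) × (f ∈Ω g)

{-# OPTIONS --safe #-}

-- On a circle of radius r, the law of sines for the angle with cosine c over a
-- chord of length ℓ reads 4 r² (1 - c²) = ℓ², so the angles are determined by
-- the squared chord lengths up to the sign of c, and distinct cosines have
-- distinct arccosines.
--
-- Upper bound: the chords of a regular m-gon take at most m lengths, because
-- the vectors w i from the centre to the vertices satisfy
-- w (i + 2) + w i = g · w (i + 1); and at most k n chords have an end among the
-- k other points.
--
-- Lower bound, for any n points on a circle: at most two of the chords from a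
-- fixed point have the same length, so there are at least (n - 1) / 2 angles.
--
-- A regular m-gon is given by the powers of z² for z = x + i √(1 - x²), where x
-- is the largest zero of the Chebyshev polynomial U m with
-- Im (z ^ d) = √(1 - x²) · U d x; it is found by the intermediate value theorem.
module Submission where

open import Defs
open import Algebra.Bundles using (CommutativeRing)
open import Algebra.Solver.Ring.AlmostCommutativeRing using (_-Raw-AlmostCommutative⟶_; fromCommutativeRing)
open import Axiom.ExcludedMiddle using (ExcludedMiddle)
open import Data.Empty using (⊥-elim)
open import Data.Fin.Base as Fin using (Fin; toℕ; combine)
import Data.Fin.Properties as Finₚ
open import Data.Integer.Base as ℤ using (ℤ; +_; -[1+_])
import Data.Integer.Properties as ℤₚ
open import Data.List.Base as List using (List; []; _∷_; _++_; length; lookup; filter; deduplicate; cartesianProductWith; allFin; upTo)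
import Data.List.Membership.Propositional as ∈
import Data.List.Membership.Propositional.Properties as ∈ₚ
import Data.List.Membership.Setoid as Membership
import Data.List.Membership.Setoid.Properties as Membershipₚ
import Data.List.Properties as Listₚ
open import Data.List.Relation.Unary.All as All using (All)
open import Data.List.Relation.Unary.AllPairs using ([]; _∷_)
open import Data.List.Relation.Unary.Any as Any using (Any; here; there)
import Data.List.Relation.Unary.Any.Properties as Anyₚ
import Data.List.Relation.Unary.Unique.DecSetoid.Properties as UniqueDecₚ
import Data.List.Relation.Unary.Unique.Propositional.Properties as Uniqueₚ
import Data.List.Relation.Unary.Unique.Setoid as Uniqueness
open import Data.Maybe.Base using (Maybe; just; nothing)
open import Data.Nat.Base as ℕ using (ℕ; zero; suc; _∸_)
open import Data.Nat.DivMod using (_%_; m<n⇒m%n≡m; m%n%n≡m%n; %-distribˡ-+; [m+n]%n≡m%n; m≤n⇒[n∸m]%m≡n%m; m%n<n; n%n≡0)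
import Data.Nat.Properties as ℕₚ
open import Data.Nat.Solver using (module +-*-Solver)
open import Data.Product using (Σ; ∃; ∃-syntax; _×_; _,_; proj₁; proj₂)
open import Data.Sum using (_⊎_; inj₁; inj₂; [_,_]′)
open import Function.Bundles using (mk⇔; Equivalence)
open import Level using (0ℓ)
open import Relation.Binary.Bundles using (Setoid; DecSetoid; StrictTotalOrder; DecTotalOrder)
open import Relation.Binary.Core using (_Preserves_⟶_)
open import Relation.Binary.Definitions using (tri<; tri≈; tri>)
import Relation.Binary.Properties.StrictTotalOrder
open import Relation.Binary.PropositionalEquality as ≡ using (_≡_; _≢_)
open import Relation.Binary.Structures using (IsStrictTotalOrder)
open import Relation.Nullary using (Dec; yes; no; ¬_; ¬?)

-- The hypothesis `1 ≤ k` is essential: for `k = 0` the bound `n * k` vanishes, whereas a regular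
-- polygon does determine angles. Since `k` is fixed, the constants may depend on it, so a lower
-- bound linear in `n` is enough, and its constant `3 * k` absorbs the factor `k`. The upper
-- constant 4 is 2 for the two kinds of chords, at most `n * k` of each, times 2 for the sign of the
-- cosine. An angle is a supremum of lengths of inscribed chains in an abstract field, so angles are
-- compared only through their cosines. This needs arccos to exist, to take values strictly between
-- 0 and π, and to be strictly decreasing. For the polygon, the half-angle point z turns
-- distinctness and convexity into positivity of the imaginary parts of z, ..., z^(m-1), and the
-- largest root of U m makes all of these positive at once. Excluded middle decides whether a chord
-- length and a sign belong to an angle, whether a real is a determined angle, and whether a count
-- is attained.

-- Ring identities with integer coefficients.

module IntegerCoefficients (R : CommutativeRing 0ℓ 0ℓ) where
  open CommutativeRing R
  open import Algebra.Properties.Ring ring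
  open import Algebra.Properties.AbelianGroup +-abelianGroup
  open import Algebra.Properties.Semiring.Mult.TCOptimised semiring renaming (_×_ to _×ᴺ_)
  open import Relation.Binary.Reasoning.Setoid setoid

  -- Coefficients are taken in `ℤ`, where equality computes, so that the solver can cancel terms;
  -- equality of reals is decided only by an abstract field of the structure. The optimised
  -- multiples reduce `1 ×ᴺ 1#` to `1#` and `2 ×ᴺ 1#` to `1# + 1#`, so `con (+ 2)` agrees
  -- definitionally with the literal in the goals.
  ⟦_⟧ℤ : ℤ → Carrier
  ⟦ + n ⟧ℤ      = n ×ᴺ 1#
  ⟦ -[1+ n ] ⟧ℤ = - (suc n ×ᴺ 1#)

  private
    cancel : ∀ x a b → (x + a) - (x + b) ≈ a - b
    cancel x a b = begin
      (x + a) - (x + b)       ≈⟨ +-cong (+-comm x a) (sym (⁻¹-∙-comm x b)) ⟩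
      (a + x) + (- x - b)     ≈⟨ +-assoc a x _ ⟩
      a + (x + (- x - b))     ≈⟨ +-congˡ (+-assoc x (- x) (- b)) ⟨
      a + ((x - x) - b)       ≈⟨ +-congˡ (+-congʳ (-‿inverseʳ x)) ⟩
      a + (0# - b)            ≈⟨ +-congˡ (+-identityˡ _) ⟩
      a - b                   ∎

    ⊖-homo : ∀ m n → ⟦ m ℤ.⊖ n ⟧ℤ ≈ m ×ᴺ 1# - n ×ᴺ 1#
    ⊖-homo m zero = begin
      m ×ᴺ 1#        ≈⟨ +-identityʳ _ ⟨
      m ×ᴺ 1# + 0#   ≈⟨ +-congˡ ε⁻¹≈ε ⟨
      m ×ᴺ 1# - 0#   ∎
    ⊖-homo zero (suc n) = sym (+-identityˡ _)
    ⊖-homo (suc m) (suc n) = begin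
      ⟦ suc m ℤ.⊖ suc n ⟧ℤ             ≡⟨ ≡.cong ⟦_⟧ℤ (ℤₚ.[1+m]⊖[1+n]≡m⊖n m n) ⟩
      ⟦ m ℤ.⊖ n ⟧ℤ                     ≈⟨ ⊖-homo m n ⟩
      m ×ᴺ 1# - n ×ᴺ 1#                  ≈⟨ cancel 1# _ _ ⟨
      (1# + m ×ᴺ 1#) - (1# + n ×ᴺ 1#)    ≈⟨ +-cong (1+× m 1#) (-‿cong (1+× n 1#)) ⟨
      suc m ×ᴺ 1# - suc n ×ᴺ 1#          ∎

    neg-homo : ∀ i → ⟦ ℤ.- i ⟧ℤ ≈ - ⟦ i ⟧ℤ
    neg-homo (+ zero)  = sym ε⁻¹≈ε
    neg-homo (+ suc n) = refl
    neg-homo -[1+ n ]  = sym (⁻¹-involutive _)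

    add-homo : ∀ i j → ⟦ i ℤ.+ j ⟧ℤ ≈ ⟦ i ⟧ℤ + ⟦ j ⟧ℤ
    add-homo (+ m) (+ n)         = ×-homo-+ 1# m n
    add-homo (+ m) -[1+ n ]      = ⊖-homo m (suc n)
    add-homo -[1+ m ] (+ n)      = trans (⊖-homo n (suc m)) (+-comm _ _)
    add-homo -[1+ m ] -[1+ n ]   = begin
      - (suc (suc (m ℕ.+ n)) ×ᴺ 1#)       ≡⟨ ≡.cong (λ k → - (suc k ×ᴺ 1#)) (ℕₚ.+-suc m n) ⟨
      - ((suc m ℕ.+ suc n) ×ᴺ 1#)         ≈⟨ -‿cong (×-homo-+ 1# (suc m) (suc n)) ⟩
      - (suc m ×ᴺ 1# + suc n ×ᴺ 1#)        ≈⟨ ⁻¹-∙-comm _ _ ⟨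
      - (suc m ×ᴺ 1#) - suc n ×ᴺ 1#        ∎

    mul-homo-ℕ : ∀ m j → ⟦ + m ℤ.* j ⟧ℤ ≈ m ×ᴺ 1# * ⟦ j ⟧ℤ
    mul-homo-ℕ m (+ n) = begin
      ⟦ + m ℤ.* + n ⟧ℤ      ≡⟨ ≡.cong ⟦_⟧ℤ (ℤₚ.pos-* m n) ⟨
      (m ℕ.* n) ×ᴺ 1#        ≈⟨ ×1-homo-* m n ⟩
      m ×ᴺ 1# * (n ×ᴺ 1#)     ∎
    mul-homo-ℕ m -[1+ n ] = begin
      ⟦ + m ℤ.* -[1+ n ] ⟧ℤ         ≡⟨ ≡.cong ⟦_⟧ℤ (ℤₚ.neg-distribʳ-* (+ m) (+ suc n)) ⟨
      ⟦ ℤ.- (+ m ℤ.* + suc n) ⟧ℤ    ≈⟨ neg-homo (+ m ℤ.* + suc n) ⟩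
      - ⟦ + m ℤ.* + suc n ⟧ℤ        ≈⟨ -‿cong (mul-homo-ℕ m (+ suc n)) ⟩
      - (m ×ᴺ 1# * (suc n ×ᴺ 1#))     ≈⟨ -‿distribʳ-* _ _ ⟩
      m ×ᴺ 1# * - (suc n ×ᴺ 1#)       ∎

    mul-homo : ∀ i j → ⟦ i ℤ.* j ⟧ℤ ≈ ⟦ i ⟧ℤ * ⟦ j ⟧ℤ
    mul-homo (+ m) j = mul-homo-ℕ m j
    mul-homo -[1+ m ] j = begin
      ⟦ -[1+ m ] ℤ.* j ⟧ℤ           ≡⟨ ≡.cong ⟦_⟧ℤ (ℤₚ.neg-distribˡ-* (+ suc m) j) ⟨
      ⟦ ℤ.- (+ suc m ℤ.* j) ⟧ℤ      ≈⟨ neg-homo (+ suc m ℤ.* j) ⟩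
      - ⟦ + suc m ℤ.* j ⟧ℤ          ≈⟨ -‿cong (mul-homo-ℕ (suc m) j) ⟩
      - (suc m ×ᴺ 1# * ⟦ j ⟧ℤ)       ≈⟨ -‿distribˡ-* _ _ ⟩
      - (suc m ×ᴺ 1#) * ⟦ j ⟧ℤ       ∎

    morphism : ℤ.+-*-rawRing -Raw-AlmostCommutative⟶ fromCommutativeRing R
    morphism = record
      { ⟦_⟧ = ⟦_⟧ℤ ; +-homo = add-homo ; *-homo = mul-homo ; -‿homo = neg-homo
      ; 0-homo = refl ; 1-homo = refl }

    _≟_ : ∀ i j → Maybe (⟦ i ⟧ℤ ≈ ⟦ j ⟧ℤ)
    i ≟ j with i ℤₚ.≟ j
    ... | yes ≡.refl = just refl
    ... | no _       = nothing

  open import Algebra.Solver.Ring ℤ.+-*-rawRing (fromCommutativeRing R) morphism _≟_ public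
    using (solve; _:=_; _:+_; _:*_; _:-_; :-_; con)

-- Arithmetic in an ordered field.

module OrderedField (ℝ : CompleteOrderedField) where
  open CompleteOrderedField ℝ
  open IntegerCoefficients commutativeRing

  strictTotalOrder : StrictTotalOrder _ _ _
  strictTotalOrder = record { isStrictTotalOrder = isStrictTotalOrder }

  open IsStrictTotalOrder isStrictTotalOrder public
    using (compare; _<?_; _≟_; <-respˡ-≈; <-respʳ-≈; irrefl; asym) renaming (trans to <-trans)

  private
    module DTO = DecTotalOrder (Relation.Binary.Properties.StrictTotalOrder.decTotalOrder strictTotalOrder)

  ≤-refl : ∀ {x} → x ≤ x
  ≤-refl = inj₂ refl

  ≤-trans : ∀ {x y z} → x ≤ y → y ≤ z → x ≤ z
  ≤-trans = DTO.trans

  ≤-antisym : ∀ {x y} → x ≤ y → y ≤ x → x ≈ y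
  ≤-antisym = DTO.antisym

  ≤-total : ∀ x y → x ≤ y ⊎ y ≤ x
  ≤-total = DTO.total

  _≤?_ : ∀ x y → Dec (x ≤ y)
  _≤?_ = DTO._≤?_

  ≤-respˡ-≈ : ∀ {x y z} → x ≈ y → x ≤ z → y ≤ z
  ≤-respˡ-≈ = DTO.≤-respˡ-≈

  ≤-respʳ-≈ : ∀ {x y z} → y ≈ z → x ≤ y → x ≤ z
  ≤-respʳ-≈ = DTO.≤-respʳ-≈

  <⇒≤ : ∀ {x y} → x < y → x ≤ y
  <⇒≤ = inj₁

  <-≤-trans : ∀ {x y z} → x < y → y ≤ z → x < z
  <-≤-trans x<y (inj₁ y<z) = <-trans x<y y<z
  <-≤-trans x<y (inj₂ y≈z) = <-respʳ-≈ y≈z x<y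

  ≤-<-trans : ∀ {x y z} → x ≤ y → y < z → x < z
  ≤-<-trans (inj₁ x<y) y<z = <-trans x<y y<z
  ≤-<-trans (inj₂ x≈y) y<z = <-respˡ-≈ (sym x≈y) y<z

  <⇒≱ : ∀ {x y} → x < y → ¬ y ≤ x
  <⇒≱ x<y y≤x = irrefl refl (<-≤-trans x<y y≤x)

  ≮⇒≥ : ∀ {x y} → ¬ x < y → y ≤ x
  ≮⇒≥ {x} {y} x≮y with compare x y
  ... | tri< x<y _ _ = ⊥-elim (x≮y x<y)
  ... | tri≈ _ x≈y _ = inj₂ (sym x≈y)
  ... | tri> _ _ y<x = inj₁ y<x

  ≰⇒> : ∀ {x y} → ¬ x ≤ y → y < x
  ≰⇒> {x} {y} x≰y with compare y x
  ... | tri< y<x _ _ = y<x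
  ... | tri≈ _ y≈x _ = ⊥-elim (x≰y (inj₂ (sym y≈x)))
  ... | tri> _ _ x<y = ⊥-elim (x≰y (inj₁ x<y))

  <⇒≉ : ∀ {x y} → x < y → ¬ x ≈ y
  <⇒≉ x<y x≈y = irrefl x≈y x<y

  -- Linear arithmetic by certificates: an equation, or an inequality, is
  -- reduced to a ring identity between a difference and a combination of
  -- the hypotheses.

  ≈-by : ∀ {x y e} → e ≈ 0# → x - y ≈ e → x ≈ y
  ≈-by {x} {y} e≈0 x-y≈e =
    trans (solve 2 (λ x y → x := (x :- y) :+ y) refl x y)
          (trans (+-congʳ (trans x-y≈e e≈0)) (+-identityˡ y))

  ≈⇒≈0 : ∀ {x y} → x ≈ y → x - y ≈ 0#
  ≈⇒≈0 {x} {y} x≈y = trans (+-congʳ x≈y) (-‿inverseʳ y)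

  multiple : ∀ c {l r} → l ≈ r → c * (l - r) ≈ 0#
  multiple c l≈r = trans (*-congˡ (≈⇒≈0 l≈r)) (zeroʳ c)

  +-zero : ∀ {x y} → x ≈ 0# → y ≈ 0# → x + y ≈ 0#
  +-zero x≈0 y≈0 = trans (+-cong x≈0 y≈0) (+-identityˡ 0#)

  combine₁ : ∀ c {x y l r} → l ≈ r → x - y ≈ c * (l - r) → x ≈ y
  combine₁ c h = ≈-by (multiple c h)

  -‿cancelʳ : ∀ {x y z} → x - z ≈ y - z → x ≈ y
  -‿cancelʳ {x} {y} {z} eq = combine₁ 1# eq
    (solve 3 (λ x y z → x :- y := con (+ 1) :* ((x :- z) :- (y :- z))) refl x y z)

  combine₂ : ∀ c c′ {x y l r l′ r′} → l ≈ r → l′ ≈ r′ →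
             x - y ≈ c * (l - r) + c′ * (l′ - r′) → x ≈ y
  combine₂ c c′ h h′ = ≈-by (+-zero (multiple c h) (multiple c′ h′))

  combine₃ : ∀ c c′ c″ {x y l r l′ r′ l″ r″} → l ≈ r → l′ ≈ r′ → l″ ≈ r″ →
             x - y ≈ c * (l - r) + c′ * (l′ - r′) + c″ * (l″ - r″) → x ≈ y
  combine₃ c c′ c″ h h′ h″ =
    ≈-by (+-zero (+-zero (multiple c h) (multiple c′ h′)) (multiple c″ h″))

  pos : ∀ {x y} → x < y → 0# < y - x
  pos {x} x<y = <-respˡ-≈ (-‿inverseʳ x) (+-monoˡ-< (- x) x<y)

  <-by : ∀ {x y e} → 0# < e → y - x ≈ e → x < y
  <-by {x} {y} 0<e y-x≈e =
    <-respˡ-≈ (+-identityˡ x)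
      (<-respʳ-≈ (solve 2 (λ x y → (y :- x) :+ x := y) refl x y)
        (+-monoˡ-< x (<-respʳ-≈ (sym y-x≈e) 0<e)))

  nonneg : ∀ {x y} → x ≤ y → 0# ≤ y - x
  nonneg (inj₁ x<y) = inj₁ (pos x<y)
  nonneg (inj₂ x≈y) = inj₂ (sym (≈⇒≈0 (sym x≈y)))

  ≤-by : ∀ {x y e} → 0# ≤ e → y - x ≈ e → x ≤ y
  ≤-by (inj₁ 0<e) eq = inj₁ (<-by 0<e eq)
  ≤-by (inj₂ 0≈e) eq = inj₂ (sym (≈-by (sym 0≈e) eq))

  +-nonneg : ∀ {x y} → 0# ≤ x → 0# ≤ y → 0# ≤ x + y
  +-nonneg {x} {y} 0≤x (inj₂ 0≈y) = ≤-respʳ-≈ (trans (sym (+-identityʳ x)) (+-congˡ 0≈y)) 0≤x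
  +-nonneg {x} {y} 0≤x (inj₁ 0<y) =
    ≤-trans 0≤x (inj₁ (<-by 0<y (solve 2 (λ x y → x :+ y :- x := y) refl x y)))

  +-pos : ∀ {x y} → 0# < x → 0# ≤ y → 0# < x + y
  +-pos {x} {y} 0<x 0≤y =
    <-≤-trans 0<x (≤-by 0≤y (solve 2 (λ x y → x :+ y :- x := y) refl x y))

  *-nonneg : ∀ {x y} → 0# ≤ x → 0# ≤ y → 0# ≤ x * y
  *-nonneg (inj₁ 0<x) (inj₁ 0<y) = inj₁ (*-pos 0<x 0<y)
  *-nonneg (inj₂ 0≈x) _          = inj₂ (trans (sym (zeroˡ _)) (*-congʳ 0≈x))
  *-nonneg _          (inj₂ 0≈y) = inj₂ (trans (sym (zeroʳ _)) (*-congˡ 0≈y))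

  neg⇒pos : ∀ {x} → x < 0# → 0# < - x
  neg⇒pos {x} x<0 = <-respʳ-≈ (+-identityˡ (- x)) (pos x<0)

  square-pos : ∀ {x} → ¬ x ≈ 0# → 0# < x * x
  square-pos {x} x≉0 with compare x 0#
  ... | tri< x<0 _ _ = <-respʳ-≈ (solve 1 (λ x → (:- x) :* (:- x) := x :* x) refl x)
                         (*-pos (neg⇒pos x<0) (neg⇒pos x<0))
  ... | tri≈ _ x≈0 _ = ⊥-elim (x≉0 x≈0)
  ... | tri> _ _ 0<x = *-pos 0<x 0<x

  square-nonneg : ∀ x → 0# ≤ x * x
  square-nonneg x with x ≟ 0#
  ... | yes x≈0 = inj₂ (sym (trans (*-congˡ x≈0) (zeroʳ x)))
  ... | no x≉0  = inj₁ (square-pos x≉0)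

  square-zero : ∀ {x} → x * x ≈ 0# → x ≈ 0#
  square-zero {x} xx≈0 with x ≟ 0#
  ... | yes x≈0 = x≈0
  ... | no x≉0  = ⊥-elim (<⇒≉ (square-pos x≉0) (sym xx≈0))

  *-cancel-zero : ∀ {x y} → ¬ x ≈ 0# → x * y ≈ 0# → y ≈ 0#
  *-cancel-zero {x} {y} x≉0 xy≈0 with x⁻¹ , xx⁻¹≈1 ← inverse x x≉0 =
    combine₂ x⁻¹ (- y) xy≈0 xx⁻¹≈1
      (solve 3 (λ x y z → y :- con (+ 0) := z :* (x :* y :- con (+ 0)) :+ (:- y) :* (x :* z :- con (+ 1)))
         refl x y x⁻¹)

  *-cancel-zero′ : ∀ {x y} → x * y ≈ 0# → x ≈ 0# ⊎ y ≈ 0#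
  *-cancel-zero′ {x} xy≈0 with x ≟ 0#
  ... | yes x≈0 = inj₁ x≈0
  ... | no x≉0  = inj₂ (*-cancel-zero x≉0 xy≈0)

  *-cancelˡ : ∀ x {y z} → ¬ x ≈ 0# → x * y ≈ x * z → y ≈ z
  *-cancelˡ x {y} {z} x≉0 xy≈xz =
    ≈-by (*-cancel-zero x≉0 (trans (solve 3 (λ x y z → x :* (y :- z) := x :* y :- x :* z) refl x y z)
                                   (≈⇒≈0 xy≈xz)))
         refl

  sum-of-squares-zero : ∀ {x y} → x * x + y * y ≈ 0# → x ≈ 0# × y ≈ 0#
  sum-of-squares-zero {x} {y} eq with x ≟ 0#
  ... | no x≉0  = ⊥-elim (<⇒≉ (+-pos (square-pos x≉0) (square-nonneg y)) (sym eq))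
  ... | yes x≈0 = x≈0 , square-zero (combine₂ 1# (- x) eq x≈0
                    (solve 2 (λ x y → y :* y :- con (+ 0)
                       := con (+ 1) :* (x :* x :+ y :* y :- con (+ 0)) :+ (:- x) :* (x :- con (+ 0))) refl x y))

  pos-cancelˡ : ∀ {x y} → 0# < x → 0# < x * y → 0# < y
  pos-cancelˡ {x} {y} 0<x 0<xy with compare 0# y
  ... | tri< 0<y _ _ = 0<y
  ... | tri≈ _ 0≈y _ = ⊥-elim (<⇒≉ 0<xy (sym (trans (*-congˡ (sym 0≈y)) (zeroʳ x))))
  ... | tri> _ _ y<0 = ⊥-elim (asym 0<xy (<-by (*-pos 0<x (neg⇒pos y<0))
          (solve 2 (λ x y → con (+ 0) :- x :* y := x :* (:- y)) refl x y)))

  square-cancel-< : ∀ {x y} → 0# ≤ y → x * x < y * y → x < y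
  square-cancel-< {x} {y} 0≤y xx<yy = ≰⇒> λ y≤x →
    <⇒≱ xx<yy (≤-by (*-nonneg (nonneg y≤x) (+-nonneg (≤-trans 0≤y y≤x) 0≤y))
      (solve 2 (λ x y → x :* x :- y :* y := (x :- y) :* (x :+ y)) refl x y))

  square-cancel-≤ : ∀ {x y} → 0# ≤ x → 0# ≤ y → x * x ≤ y * y → x ≤ y
  square-cancel-≤ 0≤x 0≤y (inj₁ xx<yy) = inj₁ (square-cancel-< 0≤y xx<yy)
  square-cancel-≤ {x} {y} 0≤x 0≤y (inj₂ xx≈yy) = ≮⇒≥ λ y<x →
    <⇒≉ (*-pos (pos y<x) (+-pos (≤-<-trans 0≤y y<x) 0≤y))
        (sym (trans (solve 2 (λ x y → (x :- y) :* (x :+ y) := x :* x :- y :* y) refl x y) (≈⇒≈0 xx≈yy)))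

  square-injective : ∀ {x y} → 0# ≤ x → 0# ≤ y → x * x ≈ y * y → x ≈ y
  square-injective 0≤x 0≤y eq =
    ≤-antisym (square-cancel-≤ 0≤x 0≤y (inj₂ eq)) (square-cancel-≤ 0≤y 0≤x (inj₂ (sym eq)))

  pos-inverse : ∀ {x} → 0# < x → ∃[ y ] (x * y ≈ 1#) × (0# < y)
  pos-inverse {x} 0<x with inverse x (λ x≈0 → <⇒≉ 0<x (sym x≈0))
  ... | y , xy≈1 = y , xy≈1 , pos-cancelˡ 0<x (<-respʳ-≈ (sym xy≈1) 0<1)

  pos⇒≉0 : ∀ {x} → 0# < x → ¬ x ≈ 0#
  pos⇒≉0 0<x x≈0 = <⇒≉ 0<x (sym x≈0)

  0≤1 : 0# ≤ 1#
  0≤1 = inj₁ 0<1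

  0<2 : 0# < 1# + 1#
  0<2 = +-pos 0<1 0≤1

-- Zeros of Lipschitz functions and square roots.

module RealRoots (ℝ : CompleteOrderedField) where
  open CompleteOrderedField ℝ
  open IntegerCoefficients commutativeRing
  open OrderedField ℝ

  -- Two one-sided bounds stand for an absolute value. An explicit constant `L` replaces continuity:
  -- it supplies the step |f t| / `L` on which `last-zero` relies.
  Lipschitz : Carrier → Carrier → Carrier → (Carrier → Carrier) → Set
  Lipschitz a b L f = ∀ {x y} → a ≤ x → x ≤ y → y ≤ b →
    (f y - f x ≤ L * (y - x)) × (f x - f y ≤ L * (y - x))

  -- The intermediate value theorem with `t` the supremum of the points of [`a`, `b`] where `f` is
  -- at most 0. This choice also gives positivity to the right of `t`, which the induction on
  -- Chebyshev polynomials depends on.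
  last-zero : ∀ {a b L} {f : Carrier → Carrier} → f Preserves _≈_ ⟶ _≈_ →
    0# < L → Lipschitz a b L f → a ≤ b → f a ≤ 0# → 0# < f b →
    ∃[ t ] (a ≤ t) × (t < b) × (f t ≈ 0#) × (∀ {x} → t < x → x ≤ b → 0# < f x)
  last-zero {a} {b} {L} {f} f-cong 0<L lip a≤b fa≤0 0<fb
    with complete (λ x → (a ≤ x) × (x ≤ b) × (f x ≤ 0#)) (a , ≤-refl , a≤b , fa≤0)
           (b , λ _ h → proj₁ (proj₂ h))
  ... | t , t-upper , t-least = t , a≤t , t<b , ft≈0 , positive
    where
    a≤t : a ≤ t
    a≤t = t-upper a (≤-refl , a≤b , fa≤0)

    t≤b : t ≤ b
    t≤b = t-least b λ _ h → proj₁ (proj₂ h)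

    positive : ∀ {x} → t < x → x ≤ b → 0# < f x
    positive {x} t<x x≤b = ≰⇒> λ fx≤0 →
      <⇒≱ t<x (t-upper x (≤-trans a≤t (<⇒≤ t<x) , x≤b , fx≤0))

    L⁻¹ : ∃[ y ] (L * y ≈ 1#) × (0# < y)
    L⁻¹ = pos-inverse 0<L

    ε : Carrier
    ε = proj₁ L⁻¹

    divide : ∀ {w z} → w ≤ L * z → ε * w ≤ z
    divide {w} {z} w≤Lz = ≤-by (*-nonneg (<⇒≤ (proj₂ (proj₂ L⁻¹))) (nonneg w≤Lz))
      (combine₁ (- z) (proj₁ (proj₂ L⁻¹))
        (solve 4 (λ l e w z → (z :- e :* w) :- e :* (l :* z :- w) := (:- z) :* (l :* e :- con (+ 1)))
          refl L ε w z))

    -- If `f t` were positive, every point of the set would lie at least `f t` / `L` to the left of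
    -- `t`, so `t - ε * f t` would be a smaller upper bound.
    ft≤0 : f t ≤ 0#
    ft≤0 = ≮⇒≥ λ 0<ft → <⇒≱ (<-by (*-pos (proj₂ (proj₂ L⁻¹)) 0<ft)
                (solve 2 (λ t d → t :- (t :- d) := d) refl t (ε * f t)))
      (t-least (t - ε * f t) λ x (a≤x , x≤b , fx≤0) →
        ≤-by (nonneg (divide (≤-trans (≤-by (nonneg fx≤0)
                (solve 2 (λ u v → (u :- v) :- u := con (+ 0) :- v) refl (f t) (f x)))
                (proj₁ (lip a≤x (t-upper x (a≤x , x≤b , fx≤0)) t≤b)))))
          (solve 3 (λ t d x → (t :- d) :- x := (t :- x) :- d) refl t (ε * f t) x))

    t<b : t < b
    t<b with t≤b
    ... | inj₁ t<b = t<b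
    ... | inj₂ t≈b = ⊥-elim (<⇒≱ 0<fb (≤-respˡ-≈ (f-cong t≈b) ft≤0))

    -- If `f t` were negative, every point of (`t`, `b`] would be farther than `δ` from `t`, because
    -- `f` is positive there and must first climb by `- f t`. The smaller of `t + δ` and `b`
    -- contradicts this.
    0≤ft : 0# ≤ f t
    0≤ft = ≮⇒≥ λ ft<0 →
      let δ = ε * (- f t)
          0<δ : 0# < δ
          0<δ = *-pos (proj₂ (proj₂ L⁻¹)) (neg⇒pos ft<0)
          far : ∀ {x} → t < x → x ≤ b → δ < x - t
          far {x} t<x x≤b = <-≤-trans
            (<-by (*-pos (proj₂ (proj₂ L⁻¹)) (positive t<x x≤b))
              (solve 3 (λ e u v → e :* (v :- u) :- e :* (:- u) := e :* v) refl ε (f t) (f x)))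
            (divide (proj₁ (lip a≤t (<⇒≤ t<x) x≤b)))
          t<t+δ : t < t + δ
          t<t+δ = <-by 0<δ (solve 2 (λ t d → (t :+ d) :- t := d) refl t δ)
      in [ (λ t+δ≤b → irrefl (solve 2 (λ t d → d := (t :+ d) :- t) refl t δ) (far t<t+δ t+δ≤b))
         , (λ b≤t+δ → <⇒≱ (far t<b ≤-refl) (≤-by (nonneg b≤t+δ)
              (solve 3 (λ t d b → d :- (b :- t) := (t :+ d) :- b) refl t δ b)))
         ]′ (≤-total (t + δ) b)

    ft≈0 : f t ≈ 0#
    ft≈0 = ≤-antisym ft≤0 0≤ft

  square-Lipschitz : ∀ a b → Lipschitz 0# b (b + b) (λ x → x * x - a)
  square-Lipschitz a b {x} {y} 0≤x x≤y y≤b =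
    ≤-by (*-nonneg (nonneg x≤y) (+-nonneg (nonneg (≤-trans x≤y y≤b)) (nonneg y≤b)))
      (solve 4 (λ x y a b → (b :+ b) :* (y :- x) :- ((y :* y :- a) :- (x :* x :- a))
         := (y :- x) :* ((b :- x) :+ (b :- y))) refl x y a b) ,
    ≤-by (*-nonneg (nonneg x≤y) (+-nonneg (+-nonneg 0≤x 0≤y) (+-nonneg (≤-trans 0≤y y≤b) (≤-trans 0≤y y≤b))))
      (solve 4 (λ x y a b → (b :+ b) :* (y :- x) :- ((x :* x :- a) :- (y :* y :- a))
         := (y :- x) :* ((x :+ y) :+ (b :+ b))) refl x y a b)
    where
    0≤y : 0# ≤ y
    0≤y = ≤-trans 0≤x x≤y

  square-root : ∀ {a} → 0# ≤ a → ∃[ s ] (0# ≤ s) × (s * s ≈ a)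
  square-root {a} 0≤a = proj₁ root , proj₁ (proj₂ root) , ≈-by (proj₁ (proj₂ (proj₂ (proj₂ root)))) refl
    where
    0<1+a : 0# < 1# + a
    0<1+a = +-pos 0<1 0≤a

    f : Carrier → Carrier
    f x = x * x - a

    f0≤0 : f 0# ≤ 0#
    f0≤0 = ≤-by 0≤a (solve 1 (λ a → con (+ 0) :- (con (+ 0) :* con (+ 0) :- a) := a) refl a)

    0<f[1+a] : 0# < f (1# + a)
    0<f[1+a] = <-by (+-pos 0<1 (+-nonneg 0≤a (square-nonneg a)))
      (solve 1 (λ a → (con (+ 1) :+ a) :* (con (+ 1) :+ a) :- a :- con (+ 0)
         := con (+ 1) :+ (a :+ a :* a)) refl a)

    root : ∃[ t ] (0# ≤ t) × (t < 1# + a) × (f t ≈ 0#) × (∀ {x} → t < x → x ≤ 1# + a → 0# < f x)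
    root = last-zero (λ x≈y → +-congʳ (*-cong x≈y x≈y)) (+-pos 0<1+a (<⇒≤ 0<1+a))
             (square-Lipschitz a (1# + a)) (<⇒≤ 0<1+a) f0≤0 0<f[1+a]

-- Arc length on the unit semicircle and the arccosine.

module Arccosine (ℝ : CompleteOrderedField) where
  open CompleteOrderedField ℝ
  open Plane ℝ
  open IntegerCoefficients commutativeRing
  open OrderedField ℝ
  open RealRoots ℝ

  dot-nonneg : ∀ u → 0# ≤ u · u
  dot-nonneg (x , y) = +-nonneg (square-nonneg x) (square-nonneg y)

  norm : ∀ u → ∃ (IsNorm u)
  norm u = square-root (dot-nonneg u)

  -ₚ-cong : ∀ {p q p′ q′} → p ≈ₚ p′ → q ≈ₚ q′ → (p -ₚ q) ≈ₚ (p′ -ₚ q′)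
  -ₚ-cong (e , f) (e′ , f′) = +-cong e (-‿cong e′) , +-cong f (-‿cong f′)

  ·-cong : ∀ {u v u′ v′} → u ≈ₚ u′ → v ≈ₚ v′ → u · v ≈ u′ · v′
  ·-cong (e , f) (e′ , f′) = +-cong (*-cong e e′) (*-cong f f′)

  ≈ₚ-refl : ∀ {p} → p ≈ₚ p
  ≈ₚ-refl = refl , refl

  ≈ₚ-sym : ∀ {p q} → p ≈ₚ q → q ≈ₚ p
  ≈ₚ-sym (e , f) = sym e , sym f

  ≈ₚ-trans : ∀ {p q r} → p ≈ₚ q → q ≈ₚ r → p ≈ₚ r
  ≈ₚ-trans (e , f) (e′ , f′) = trans e e′ , trans f f′

  norm-cong : ∀ {u v s} → u ≈ₚ v → IsNorm u s → IsNorm v s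
  norm-cong u≈v (0≤s , ss≈) = 0≤s , trans ss≈ (·-cong u≈v u≈v)

  distance-cong : ∀ {p p′ q q′ d} → p ≈ₚ p′ → q ≈ₚ q′ → IsDistance p q d → IsDistance p′ q′ d
  distance-cong p≈p′ q≈q′ = norm-cong (-ₚ-cong q≈q′ p≈p′)

  semicircle-cong : ∀ {p q} → p ≈ₚ q → OnUpperUnitSemicircle p → OnUpperUnitSemicircle q
  semicircle-cong p≈q (on , 0≤y) =
    trans (sym (·-cong p≈q p≈q)) on , ≤-respʳ-≈ (proj₂ p≈q) 0≤y

  chain-cong : ∀ {p q ℓ} → p ≈ₚ q → InscribedChain p ℓ → InscribedChain q ℓ
  chain-cong p≈q (start p≈e) = start (≈ₚ-trans (≈ₚ-sym p≈q) p≈e)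
  chain-cong p≈q (extend chain on lt dist) =
    extend chain (semicircle-cong p≈q on) (<-respˡ-≈ (proj₁ p≈q) lt) (distance-cong ≈ₚ-refl p≈q dist)

  chain-end : ∀ {p ℓ} → InscribedChain p ℓ → OnUpperUnitSemicircle p
  chain-end (start p≈e) = semicircle-cong (≈ₚ-sym p≈e)
    (solve 0 (con (+ 1) :* con (+ 1) :+ con (+ 0) :* con (+ 0) := con (+ 1)) refl , ≤-refl)
  chain-end (extend _ on _ _) = on

  unit-bound : ∀ {x y} → x * x + y * y ≈ 1# → y ≤ 1#
  unit-bound {x} {y} eq = ≮⇒≥ λ 1<y → <⇒≱ (*-pos (pos 1<y) (+-pos (<-trans 0<1 1<y) 0≤1))
    (≤-by (square-nonneg x) (combine₁ (- 1#) eq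
      (solve 2 (λ x y → (con (+ 0) :- (y :- con (+ 1)) :* (y :+ con (+ 1))) :- x :* x
         := (:- con (+ 1)) :* (x :* x :+ y :* y :- con (+ 1))) refl x y)))

  abscissa-bound : ∀ {x y} → x * x + y * y ≈ 1# → - 1# ≤ x
  abscissa-bound {x} {y} eq = ≤-by (nonneg (unit-bound (trans
      (solve 2 (λ x y → y :* y :+ (:- x) :* (:- x) := x :* x :+ y :* y) refl x y) eq)))
    (solve 1 (λ x → x :- (:- con (+ 1)) := con (+ 1) :- (:- x)) refl x)

  -- The taxicab bound, from (Δ + `e`)² - `d`² = (`e`² - (`y′ - y`)²) + 2 Δ `e` with Δ = `x - x′`.
  -- Leaving `e` free lets it be the rise, the fall, or the detour over the top of the circle.
  chord-bound : ∀ {x y x′ y′ d e} → IsDistance (x , y) (x′ , y′) d → x′ ≤ x → 0# ≤ e →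
    (y′ - y) * (y′ - y) ≤ e * e → d ≤ (x - x′) + e
  chord-bound {x} {y} {x′} {y′} {d} {e} (0≤d , dd≈) x′≤x 0≤e bound =
    square-cancel-≤ 0≤d (+-nonneg (nonneg x′≤x) 0≤e)
      (≤-by (+-nonneg (nonneg bound) (*-nonneg (*-nonneg (<⇒≤ 0<2) (nonneg x′≤x)) 0≤e))
        (combine₁ (- 1#) dd≈
          (solve 6 (λ x y x′ y′ d e →
            ((x :- x′ :+ e) :* (x :- x′ :+ e) :- d :* d)
              :- ((e :* e :- (y′ :- y) :* (y′ :- y)) :+ con (+ 2) :* (x :- x′) :* e)
            := (:- con (+ 1)) :* (d :* d :- ((x′ :- x) :* (x′ :- x) :+ (y′ :- y) :* (y′ :- y))))
            refl x y x′ y′ d e)))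

  -- In a quadrant both coordinates are monotone along the circle, so there the
  -- taxicab length of a chain telescopes.
  record QuadrantBounds (x y ℓ : Carrier) : Set where
    field
      first  : 0# ≤ x → ℓ ≤ (1# - x) + y
      second : x ≤ 0# → ℓ ≤ (1# - x) + ((1# + 1#) - y)

  open QuadrantBounds

  chain-bounds : ∀ {p ℓ} → InscribedChain p ℓ → QuadrantBounds (proj₁ p) (proj₂ p) ℓ
  chain-bounds {x , y} (start (x≈1 , y≈0)) = record
    { first = λ _ → inj₂ (combine₂ 1# (- 1#) x≈1 y≈0
        (solve 2 (λ x y → con (+ 0) :- ((con (+ 1) :- x) :+ y)
          := con (+ 1) :* (x :- con (+ 1)) :+ (:- con (+ 1)) :* (y :- con (+ 0))) refl x y))
    ; second = λ x≤0 → ⊥-elim (<⇒≱ 0<1 (≤-respˡ-≈ x≈1 x≤0)) }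
  chain-bounds {x′ , y′} (extend {p = x , y} {ℓ = ℓ} {d = d} chain (on′ , 0≤y′) x′<x dist) = record
    { first = λ 0≤x′ → ≤-by
        (+-nonneg (nonneg (first IH (≤-trans 0≤x′ (<⇒≤ x′<x))))
                  (nonneg (chord-bound dist (<⇒≤ x′<x) (nonneg (rising 0≤x′)) ≤-refl)))
        (solve 6 (λ x y x′ y′ ℓ d → ((con (+ 1) :- x′) :+ y′) :- (ℓ :+ d)
           := ((con (+ 1) :- x) :+ y :- ℓ) :+ ((x :- x′) :+ (y′ :- y) :- d)) refl x y x′ y′ ℓ d)
    ; second = λ x′≤0 → [ over-the-top , falling-case x′≤0 ]′ (≤-total 0# x) }
    where
    IH : QuadrantBounds x y ℓ
    IH = chain-bounds chain

    on : x * x + y * y ≈ 1#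
    on = proj₁ (chain-end chain)

    0≤y : 0# ≤ y
    0≤y = proj₂ (chain-end chain)

    rising : 0# ≤ x′ → y ≤ y′
    rising 0≤x′ = square-cancel-≤ 0≤y 0≤y′
      (≤-by (*-nonneg (nonneg (<⇒≤ x′<x)) (+-nonneg (≤-trans 0≤x′ (<⇒≤ x′<x)) 0≤x′))
        (combine₂ 1# (- 1#) on′ on
          (solve 4 (λ x y x′ y′ → y′ :* y′ :- y :* y :- (x :- x′) :* (x :+ x′)
             := con (+ 1) :* (x′ :* x′ :+ y′ :* y′ :- con (+ 1))
                :+ (:- con (+ 1)) :* (x :* x :+ y :* y :- con (+ 1))) refl x y x′ y′)))

    -- A chord from the first quadrant to the second is compared with the path through height 1, so
    -- `e` is `(1# - y) + (1# - y′)`; its square exceeds (`y′ - y`)² by 4 (1 - `y`) (1 - `y′`).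
    over-the-top : 0# ≤ x → ℓ + d ≤ (1# - x′) + ((1# + 1#) - y′)
    over-the-top 0≤x = ≤-by
      (+-nonneg (nonneg (first IH 0≤x))
        (nonneg (chord-bound dist (<⇒≤ x′<x) (+-nonneg 0≤1-y 0≤1-y′)
          (≤-by (*-nonneg (+-nonneg 0≤1-y 0≤1-y) (+-nonneg 0≤1-y′ 0≤1-y′))
            (solve 2 (λ y y′ → ((con (+ 1) :- y) :+ (con (+ 1) :- y′)) :* ((con (+ 1) :- y) :+ (con (+ 1) :- y′))
                :- (y′ :- y) :* (y′ :- y)
                := ((con (+ 1) :- y) :+ (con (+ 1) :- y)) :* ((con (+ 1) :- y′) :+ (con (+ 1) :- y′)))
              refl y y′)))))
      (solve 6 (λ x y x′ y′ ℓ d → ((con (+ 1) :- x′) :+ (con (+ 2) :- y′)) :- (ℓ :+ d)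
         := ((con (+ 1) :- x) :+ y :- ℓ)
            :+ ((x :- x′) :+ ((con (+ 1) :- y) :+ (con (+ 1) :- y′)) :- d)) refl x y x′ y′ ℓ d)
      where
      0≤1-y : 0# ≤ 1# - y
      0≤1-y = nonneg (unit-bound on)
      0≤1-y′ : 0# ≤ 1# - y′
      0≤1-y′ = nonneg (unit-bound on′)

    falling : x ≤ 0# → y′ ≤ y
    falling x≤0 = square-cancel-≤ 0≤y′ 0≤y
      (≤-by (*-nonneg (nonneg (<⇒≤ x′<x)) (+-nonneg (nonneg x≤0) (nonneg (≤-trans (<⇒≤ x′<x) x≤0))))
        (combine₂ 1# (- 1#) on on′
          (solve 4 (λ x y x′ y′ → y :* y :- y′ :* y′ :- (x :- x′) :* ((con (+ 0) :- x) :+ (con (+ 0) :- x′))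
             := con (+ 1) :* (x :* x :+ y :* y :- con (+ 1))
                :+ (:- con (+ 1)) :* (x′ :* x′ :+ y′ :* y′ :- con (+ 1))) refl x y x′ y′)))

    falling-case : x′ ≤ 0# → x ≤ 0# → ℓ + d ≤ (1# - x′) + ((1# + 1#) - y′)
    falling-case x′≤0 x≤0 = ≤-by
      (+-nonneg (nonneg (second IH x≤0))
        (nonneg (chord-bound dist (<⇒≤ x′<x) (nonneg (falling x≤0))
          (inj₂ (solve 2 (λ y y′ → (y′ :- y) :* (y′ :- y) := (y :- y′) :* (y :- y′)) refl y y′)))))
      (solve 6 (λ x y x′ y′ ℓ d → ((con (+ 1) :- x′) :+ (con (+ 2) :- y′)) :- (ℓ :+ d)
         := ((con (+ 1) :- x) :+ (con (+ 2) :- y) :- ℓ)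
            :+ ((x :- x′) :+ (y :- y′) :- d)) refl x y x′ y′ ℓ d)

  -- 4 is the taxicab length of the whole semicircle: 2 horizontally, 1 up and 1 down. It provides
  -- the upper bound that completeness asks for.
  chain-length-bound : ∀ {p ℓ} → InscribedChain p ℓ → ℓ ≤ (1# + 1#) + (1# + 1#)
  chain-length-bound {x , y} {ℓ} chain = [ case₁ , case₂ ]′ (≤-total 0# x)
    where
    on : x * x + y * y ≈ 1#
    on = proj₁ (chain-end chain)

    case₁ : 0# ≤ x → ℓ ≤ (1# + 1#) + (1# + 1#)
    case₁ 0≤x = ≤-trans (first (chain-bounds chain) 0≤x)
      (≤-by (+-nonneg (+-nonneg 0≤x (nonneg (unit-bound on))) (<⇒≤ 0<2))
        (solve 2 (λ x y → con (+ 2) :+ con (+ 2) :- ((con (+ 1) :- x) :+ y)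
           := (x :+ (con (+ 1) :- y)) :+ con (+ 2)) refl x y))

    case₂ : x ≤ 0# → ℓ ≤ (1# + 1#) + (1# + 1#)
    case₂ x≤0 = ≤-trans (second (chain-bounds chain) x≤0)
      (≤-by (+-nonneg (nonneg (abscissa-bound on)) (proj₂ (chain-end chain)))
        (solve 2 (λ x y → con (+ 2) :+ con (+ 2) :- ((con (+ 1) :- x) :+ (con (+ 2) :- y))
           := (x :- (:- con (+ 1))) :+ y) refl x y))

  semicircle-point : ∀ {c} → 0# ≤ 1# - c * c → ∃[ y ] OnUpperUnitSemicircle (c , y)
  semicircle-point {c} h = proj₁ root ,
    combine₁ 1# (proj₂ (proj₂ root))
      (solve 2 (λ c y → (c :* c :+ y :* y) :- con (+ 1) := con (+ 1) :* (y :* y :- (con (+ 1) :- c :* c)))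
        refl c (proj₁ root)) ,
    proj₁ (proj₂ root)
    where
    root : ∃[ y ] (0# ≤ y) × (y * y ≈ 1# - c * c)
    root = square-root h

  distance-pos : ∀ {p q d} → proj₁ q < proj₁ p → IsDistance p q d → 0# < d
  distance-pos {x , y} {x′ , y′} {d} x′<x (inj₁ 0<d , _) = 0<d
  distance-pos {x , y} {x′ , y′} {d} x′<x (inj₂ 0≈d , dd≈) = ⊥-elim (<⇒≉ x′<x
    (≈-by (proj₁ (sum-of-squares-zero {x′ - x} {y′ - y}
      (trans (sym dd≈) (trans (*-congˡ (sym 0≈d)) (zeroʳ d))))) refl))

  short-chain : ∀ {c} → 0# ≤ 1# - c * c → c < 1# → ∃[ y ] ∃[ ℓ ] InscribedChain (c , y) ℓ × (0# < ℓ)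
  short-chain {c} h c<1 = proj₁ point , _ ,
    extend (start ≈ₚ-refl) (proj₂ point) c<1 (proj₂ dist) ,
    <-respʳ-≈ (sym (+-identityˡ _)) (distance-pos c<1 (proj₂ dist))
    where
    point : ∃[ y ] OnUpperUnitSemicircle (c , y)
    point = semicircle-point h
    dist : ∃ (IsDistance (1# , 0#) (c , proj₁ point))
    dist = norm _

  arccos-exists : ∀ {c} → 0# ≤ 1# - c * c → c < 1# → ∃ (IsArccos c)
  arccos-exists {c} h c<1 = complete _ (proj₁ (proj₂ short) , proj₁ short , proj₁ (proj₂ (proj₂ short)))
    (_ , λ _ (_ , chain) → chain-length-bound chain)
    where
    short : ∃[ y ] ∃[ ℓ ] InscribedChain (c , y) ℓ × (0# < ℓ)
    short = short-chain h c<1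

  arccos-pos : ∀ {c θ} → 0# ≤ 1# - c * c → c < 1# → IsArccos c θ → 0# < θ
  arccos-pos h c<1 (upper , _) = <-≤-trans (proj₂ (proj₂ (proj₂ short)))
    (upper _ (proj₁ short , proj₁ (proj₂ (proj₂ short))))
    where
    short : ∃[ y ] ∃[ ℓ ] InscribedChain (_ , y) ℓ × (0# < ℓ)
    short = short-chain h c<1

  arccos-unique : ∀ {c c′ θ θ′} → c ≈ c′ → IsArccos c θ → IsArccos c′ θ′ → θ ≈ θ′
  arccos-unique c≈c′ (upper , least) (upper′ , least′) = ≤-antisym
    (least _ λ ℓ (y , chain) → upper′ ℓ (y , chain-cong (c≈c′ , refl) chain))
    (least′ _ λ ℓ (y , chain) → upper ℓ (y , chain-cong (sym c≈c′ , refl) chain))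

  arccos-resp : ∀ {c θ θ′} → θ ≈ θ′ → IsArccos c θ → IsArccos c θ′
  arccos-resp θ≈θ′ (upper , least) =
    (λ ℓ chain → ≤-respʳ-≈ θ≈θ′ (upper ℓ chain)) , λ b bound → ≤-respˡ-≈ θ≈θ′ (least b bound)

  -- Every chain ending at abscissa `c` can be prolonged by the chord to abscissa `c′`, so
  -- `θ + d ≤ θ′`. The length `d` is the same for all these chains, since a point of the upper
  -- semicircle is determined by its abscissa, and it is positive.
  arccos-decreasing : ∀ {c c′ θ θ′} → 0# ≤ 1# - c * c → 0# ≤ 1# - c′ * c′ → c′ < c →
    IsArccos c θ → IsArccos c′ θ′ → θ < θ′
  arccos-decreasing {c} {c′} {θ} {θ′} h h′ c′<c (_ , least) (upper′ , _) =
    ≤-<-trans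
      (least (θ′ - d) λ ℓ (y₀ , chain) →
        ≤-by (nonneg (upper′ (ℓ + d) (y′ , extend chain (proj₂ point′) c′<c
               (distance-cong (refl , same-height (chain-end chain)) ≈ₚ-refl (proj₂ dist)))))
          (solve 3 (λ t d ℓ → t :- d :- ℓ := t :- (ℓ :+ d)) refl θ′ d ℓ))
      (<-by (distance-pos c′<c (proj₂ dist))
        (solve 2 (λ t d → t :- (t :- d) := d) refl θ′ d))
    where
    point : ∃[ y ] OnUpperUnitSemicircle (c , y)
    point = semicircle-point h
    point′ : ∃[ y ] OnUpperUnitSemicircle (c′ , y)
    point′ = semicircle-point h′
    y y′ : Carrier
    y  = proj₁ point
    y′ = proj₁ point′
    dist : ∃ (IsDistance (c , y) (c′ , y′))
    dist = norm _
    d : Carrier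
    d = proj₁ dist
    same-height : ∀ {y₀} → OnUpperUnitSemicircle (c , y₀) → y ≈ y₀
    same-height {y₀} (on₀ , 0≤y₀) = square-injective (proj₂ (proj₂ point)) 0≤y₀
      (combine₂ 1# (- 1#) (proj₁ (proj₂ point)) on₀
        (solve 3 (λ c y z → y :* y :- z :* z
           := con (+ 1) :* (c :* c :+ y :* y :- con (+ 1)) :+ (:- con (+ 1)) :* (c :* c :+ z :* z :- con (+ 1)))
          refl c y y₀))

  arccos-injective : ∀ {c c′ θ θ′} → 0# ≤ 1# - c * c → 0# ≤ 1# - c′ * c′ →
    IsArccos c θ → IsArccos c′ θ′ → θ ≈ θ′ → c ≈ c′
  arccos-injective {c} {c′} h h′ arc arc′ θ≈θ′ with compare c c′
  ... | tri≈ _ c≈c′ _ = c≈c′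
  ... | tri< c<c′ _ _ = ⊥-elim (<⇒≉ (arccos-decreasing h′ h c<c′ arc′ arc) (sym θ≈θ′))
  ... | tri> _ _ c′<c = ⊥-elim (<⇒≉ (arccos-decreasing h h′ c′<c arc arc′) θ≈θ′)

  abscissa-of-unit : ∀ {c} → 0# < 1# - c * c → (- 1# < c) × (c < 1#)
  abscissa-of-unit {c} h =
    ≰⇒> (λ c≤-1 → <⇒≱ h (≤-by (*-nonneg (nonneg c≤-1) (+-nonneg (nonneg c≤-1) (<⇒≤ 0<2)))
      (solve 1 (λ c → con (+ 0) :- (con (+ 1) :- c :* c)
         := ((:- con (+ 1)) :- c) :* (((:- con (+ 1)) :- c) :+ con (+ 2))) refl c))) ,
    ≰⇒> (λ 1≤c → <⇒≱ h (≤-by (*-nonneg (nonneg 1≤c) (+-nonneg (nonneg 1≤c) (<⇒≤ 0<2)))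
      (solve 1 (λ c → con (+ 0) :- (con (+ 1) :- c :* c)
         := (c :- con (+ 1)) :* ((c :- con (+ 1)) :+ con (+ 2))) refl c)))

  arccos-below-π : ∀ {c θ} → 0# < 1# - c * c → IsArccos c θ → ∃[ π ] Isπ π × (θ < π)
  arccos-below-π {c} h arc = proj₁ isπ , proj₂ isπ ,
    arccos-decreasing (<⇒≤ h) zero≤ (proj₁ (abscissa-of-unit h)) arc (proj₂ isπ)
    where
    zero≤ : 0# ≤ 1# - (- 1#) * (- 1#)
    zero≤ = inj₂ (solve 0 (con (+ 0) := con (+ 1) :- (:- con (+ 1)) :* (:- con (+ 1))) refl)
    isπ : ∃ Isπ
    isπ = arccos-exists zero≤ (<-by 0<2 (solve 0 (con (+ 1) :- (:- con (+ 1)) := con (+ 2)) refl))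

-- The law of sines for inscribed angles.

module InscribedAngles (ℝ : CompleteOrderedField) where
  open CompleteOrderedField ℝ
  open Plane ℝ
  open IntegerCoefficients commutativeRing
  open OrderedField ℝ
  open Arccosine ℝ

  dist² : Point → Point → Carrier
  dist² p q = (q -ₚ p) · (q -ₚ p)

  dist²-sym : ∀ p q → dist² p q ≈ dist² q p
  dist²-sym (p₁ , p₂) (q₁ , q₂) = solve 4 (λ p₁ p₂ q₁ q₂ →
    (q₁ :- p₁) :* (q₁ :- p₁) :+ (q₂ :- p₂) :* (q₂ :- p₂)
    := (p₁ :- q₁) :* (p₁ :- q₁) :+ (p₂ :- q₂) :* (p₂ :- q₂)) refl p₁ p₂ q₁ q₂

  dist²-pos : ∀ {p q} → ¬ p ≈ₚ q → 0# < dist² q p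
  dist²-pos {p} {q} p≉q with dot-nonneg (p -ₚ q)
  ... | inj₁ 0<d = 0<d
  ... | inj₂ 0≈d = ⊥-elim (p≉q (≈-by (proj₁ zeros) refl , ≈-by (proj₂ zeros) refl))
    where
    zeros : (proj₁ p - proj₁ q ≈ 0#) × (proj₂ p - proj₂ q ≈ 0#)
    zeros = sum-of-squares-zero (sym 0≈d)

  norm-pos : ∀ {u s} → 0# < u · u → IsNorm u s → 0# < s
  norm-pos 0<uu (inj₁ 0<s , _) = 0<s
  norm-pos 0<uu (inj₂ 0≈s , ss≈) = ⊥-elim (<⇒≉ 0<uu (trans (sym (trans (*-congʳ (sym 0≈s)) (zeroˡ _))) ss≈))

  cosine-exists : ∀ {u v} → 0# < u · u → 0# < v · v → ∃ (IsCosine u v)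
  cosine-exists {u} {v} 0<uu 0<vv = (u · v) * w , s , t , proj₂ (norm u) , proj₂ (norm v) ,
    combine₁ (u · v) (proj₁ (proj₂ w-inverse))
      (solve 4 (λ d w s t → d :* w :* (s :* t) :- d := d :* ((s :* t) :* w :- con (+ 1))) refl (u · v) w s t)
    where
    s t : Carrier
    s = proj₁ (norm u)
    t = proj₁ (norm v)
    w-inverse : ∃[ w ] (s * t * w ≈ 1#) × (0# < w)
    w-inverse = pos-inverse (*-pos (norm-pos 0<uu (proj₂ (norm u))) (norm-pos 0<vv (proj₂ (norm v))))
    w : Carrier
    w = proj₁ w-inverse

  -- Lagrange's identity |u|² |v|² = (`u · v`)² + (`cross u v`)², with `c` |u| |v| put for `u · v`.
  1-cosine² : ∀ {u v c} → IsCosine u v c → (u · u) * (v · v) * (1# - c * c) ≈ cross u v * cross u v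
  1-cosine² {u₁ , u₂} {v₁ , v₂} {c} (s , t , (_ , ss≈) , (_ , tt≈) , cst≈) =
    combine₃ (c * c * (v₁ * v₁ + v₂ * v₂)) (c * c * (s * s))
      (- (c * (s * t) + (u₁ * v₁ + u₂ * v₂))) ss≈ tt≈ cst≈
      (solve 7 (λ u₁ u₂ v₁ v₂ s t c →
        (u₁ :* u₁ :+ u₂ :* u₂) :* (v₁ :* v₁ :+ v₂ :* v₂) :* (con (+ 1) :- c :* c)
          :- (u₁ :* v₂ :- u₂ :* v₁) :* (u₁ :* v₂ :- u₂ :* v₁)
        := c :* c :* (v₁ :* v₁ :+ v₂ :* v₂) :* (s :* s :- (u₁ :* u₁ :+ u₂ :* u₂))
           :+ c :* c :* (s :* s) :* (t :* t :- (v₁ :* v₁ :+ v₂ :* v₂))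
           :+ (:- (c :* (s :* t) :+ (u₁ :* v₁ :+ u₂ :* v₂))) :* (c :* (s :* t) :- (u₁ :* v₁ :+ u₂ :* v₂)))
        refl u₁ u₂ v₁ v₂ s t c)

  -- Expand w in the dual basis of u, v and take norms.
  gram : ∀ w u v → (w · w) * (cross u v * cross u v) ≈
    (w · u) * (w · u) * (v · v) + (w · v) * (w · v) * (u · u) - (1# + 1#) * ((w · u) * (w · v) * (u · v))
  gram (w₁ , w₂) (u₁ , u₂) (v₁ , v₂) =
    solve 6 (λ w₁ w₂ u₁ u₂ v₁ v₂ →
      (w₁ :* w₁ :+ w₂ :* w₂) :* ((u₁ :* v₂ :- u₂ :* v₁) :* (u₁ :* v₂ :- u₂ :* v₁))
      := (w₁ :* u₁ :+ w₂ :* u₂) :* (w₁ :* u₁ :+ w₂ :* u₂) :* (v₁ :* v₁ :+ v₂ :* v₂)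
         :+ (w₁ :* v₁ :+ w₂ :* v₂) :* (w₁ :* v₁ :+ w₂ :* v₂) :* (u₁ :* u₁ :+ u₂ :* u₂)
         :- con (+ 2) :* ((w₁ :* u₁ :+ w₂ :* u₂) :* (w₁ :* v₁ :+ w₂ :* v₂) :* (u₁ :* v₁ :+ u₂ :* v₂)))
      refl w₁ w₂ u₁ u₂ v₁ v₂

  module Circle (o : Point) (r : Carrier) (0<r : 0# < r) where

    OnIt : Point → Set
    OnIt p = IsDistance o p r

    private
      -- The centre projects onto the midpoint of a chord.
      chord-relation : ∀ {p q} → OnIt p → OnIt q → (1# + 1#) * ((o -ₚ q) · (p -ₚ q)) ≈ (p -ₚ q) · (p -ₚ q)
      chord-relation {p₁ , p₂} {q₁ , q₂} (_ , onp) (_ , onq) =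
        combine₂ 1# (- 1#) onp onq
          (solve 7 (λ p₁ p₂ q₁ q₂ o₁ o₂ r →
            con (+ 2) :* ((o₁ :- q₁) :* (p₁ :- q₁) :+ (o₂ :- q₂) :* (p₂ :- q₂))
              :- ((p₁ :- q₁) :* (p₁ :- q₁) :+ (p₂ :- q₂) :* (p₂ :- q₂))
            := con (+ 1) :* (r :* r :- ((p₁ :- o₁) :* (p₁ :- o₁) :+ (p₂ :- o₂) :* (p₂ :- o₂)))
               :+ (:- con (+ 1)) :* (r :* r :- ((q₁ :- o₁) :* (q₁ :- o₁) :+ (q₂ :- o₂) :* (q₂ :- o₂))))
            refl p₁ p₂ q₁ q₂ (proj₁ o) (proj₂ o) r)

      radius : ∀ {q} → OnIt q → (o -ₚ q) · (o -ₚ q) ≈ r * r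
      radius {q₁ , q₂} (_ , onq) = combine₁ (- 1#) onq
        (solve 5 (λ q₁ q₂ o₁ o₂ r →
          ((o₁ :- q₁) :* (o₁ :- q₁) :+ (o₂ :- q₂) :* (o₂ :- q₂)) :- r :* r
          := (:- con (+ 1)) :* (r :* r :- ((q₁ :- o₁) :* (q₁ :- o₁) :+ (q₂ :- o₂) :* (q₂ :- o₂))))
          refl q₁ q₂ (proj₁ o) (proj₂ o) r)

    4r² : Carrier
    4r² = (r + r) * (r + r)

    0<4r² : 0# < 4r²
    0<4r² = *-pos (+-pos 0<r (<⇒≤ 0<r)) (+-pos 0<r (<⇒≤ 0<r))

    -- After multiplication by `A * B` the left side is 4 `r`² `K`². Since |`w`| = `r`, `gram`
    -- rewrites it as 4 (`X`² `B` + `Y`² `A` - 2 `X` `Y` `D`), and 2 `X` = `A`, 2 `Y` = `B` turn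
    -- that into `A` `B` (`A` + `B` - 2 `D`). The last factor is the squared chord by the law of
    -- cosines.
    law-of-sines : ∀ {p q s c} → OnIt p → OnIt q → OnIt s → ¬ p ≈ₚ q → ¬ s ≈ₚ q →
      IsCosine (p -ₚ q) (s -ₚ q) c → 4r² * (1# - c * c) ≈ dist² p s
    law-of-sines {p} {q} {s} {c} onp onq ons p≉q s≉q cosine =
      *-cancelˡ (A * B) (pos⇒≉0 (*-pos (dist²-pos p≉q) (dist²-pos s≉q)))
        (trans (combine₂ ((1# + 1#) * (1# + 1#) * (r * r)) (- ((1# + 1#) * (1# + 1#) * (K * K)))
                 (1-cosine² cosine) (radius onq)
                 (solve 6 (λ r A B c K W →
                   (A :* B) :* (((r :+ r) :* (r :+ r)) :* (con (+ 1) :- c :* c)) :- con (+ 4) :* (W :* (K :* K))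
                   := con (+ 2) :* con (+ 2) :* (r :* r) :* (A :* B :* (con (+ 1) :- c :* c) :- K :* K)
                      :+ (:- (con (+ 2) :* con (+ 2) :* (K :* K))) :* (W :- r :* r))
                   refl r A B c K W))
        (trans (*-congˡ (gram w u v))
        (trans (combine₂ (X * B * (1# + 1#) + A * B - (1# + 1#) * (1# + 1#) * Y * D)
                         (Y * A * (1# + 1#) + A * B - (1# + 1#) * A * D)
                 (chord-relation onp onq) (chord-relation ons onq)
                 (solve 5 (λ A B D X Y →
                   con (+ 4) :* (X :* X :* B :+ Y :* Y :* A :- con (+ 2) :* (X :* Y :* D))
                     :- (A :* B) :* (A :+ B :- con (+ 2) :* D)
                   := (X :* B :* con (+ 2) :+ A :* B :- con (+ 2) :* con (+ 2) :* Y :* D) :* (con (+ 2) :* X :- A)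
                      :+ (Y :* A :* con (+ 2) :+ A :* B :- con (+ 2) :* A :* D) :* (con (+ 2) :* Y :- B))
                   refl A B D X Y))
        (*-congˡ (solve 6 (λ p₁ p₂ q₁ q₂ s₁ s₂ →
            ((p₁ :- q₁) :* (p₁ :- q₁) :+ (p₂ :- q₂) :* (p₂ :- q₂))
              :+ ((s₁ :- q₁) :* (s₁ :- q₁) :+ (s₂ :- q₂) :* (s₂ :- q₂))
              :- con (+ 2) :* ((p₁ :- q₁) :* (s₁ :- q₁) :+ (p₂ :- q₂) :* (s₂ :- q₂))
            := (s₁ :- p₁) :* (s₁ :- p₁) :+ (s₂ :- p₂) :* (s₂ :- p₂))
            refl (proj₁ p) (proj₂ p) (proj₁ q) (proj₂ q) (proj₁ s) (proj₂ s))))))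
      where
      u v w : Point
      u = p -ₚ q
      v = s -ₚ q
      w = o -ₚ q
      A B D X Y W K : Carrier
      A = u · u
      B = v · v
      D = u · v
      X = w · u
      Y = w · v
      W = w · w
      K = cross u v

    sine-pos : ∀ {p q s c} → OnIt p → OnIt q → OnIt s → ¬ p ≈ₚ q → ¬ s ≈ₚ q → ¬ s ≈ₚ p →
      IsCosine (p -ₚ q) (s -ₚ q) c → 0# < 1# - c * c
    sine-pos onp onq ons p≉q s≉q s≉p cosine =
      pos-cancelˡ 0<4r² (<-respʳ-≈ (sym (law-of-sines onp onq ons p≉q s≉q cosine)) (dist²-pos s≉p))

    record InscribedAngle (p q s : Point) : Set where
      field
        θ c      : Carrier
        cosine   : IsCosine (p -ₚ q) (s -ₚ q) c
        arccos   : IsArccos c θ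
        sines    : 4r² * (1# - c * c) ≈ dist² p s
        proper   : 0# < 1# - c * c
        positive : 0# < θ
        below-π  : ∃[ π ] Isπ π × (θ < π)

    inscribed-angle : ∀ {p q s} → OnIt p → OnIt q → OnIt s → ¬ p ≈ₚ q → ¬ s ≈ₚ q → ¬ s ≈ₚ p →
      InscribedAngle p q s
    inscribed-angle {p} {q} {s} onp onq ons p≉q s≉q s≉p = record
      { θ        = proj₁ arc
      ; c        = proj₁ cos
      ; cosine   = proj₂ cos
      ; arccos   = proj₂ arc
      ; sines    = law-of-sines onp onq ons p≉q s≉q (proj₂ cos)
      ; proper   = proper
      ; positive = arccos-pos (<⇒≤ proper) (proj₂ (abscissa-of-unit proper)) (proj₂ arc)
      ; below-π  = arccos-below-π proper (proj₂ arc) }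
      where
      cos : ∃ (IsCosine (p -ₚ q) (s -ₚ q))
      cos = cosine-exists (dist²-pos p≉q) (dist²-pos s≉q)
      proper : 0# < 1# - proj₁ cos * proj₁ cos
      proper = sine-pos onp onq ons p≉q s≉q s≉p (proj₂ cos)
      arc : ∃ (IsArccos (proj₁ cos))
      arc = arccos-exists (<⇒≤ proper) (proj₂ (abscissa-of-unit proper))

-- Counting with duplicate-free lists.

module UniqueLists (S : Setoid 0ℓ 0ℓ) where
  open Setoid S
  open Membership S
  open Uniqueness S using (Unique)

  lookup-apart : ∀ {x xs} → All (λ y → ¬ x ≈ y) xs → ∀ i → ¬ x ≈ lookup xs i
  lookup-apart (x≉y All.∷ _) Fin.zero    = x≉y
  lookup-apart (_ All.∷ x∉)  (Fin.suc i) = lookup-apart x∉ i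

  lookup-injective : ∀ {xs} → Unique xs → ∀ i j → lookup xs i ≈ lookup xs j → i ≡ j
  lookup-injective (_ ∷ _)   Fin.zero    Fin.zero    _  = ≡.refl
  lookup-injective (x∉ ∷ _)  Fin.zero    (Fin.suc j) eq = ⊥-elim (lookup-apart x∉ j eq)
  lookup-injective (x∉ ∷ _)  (Fin.suc i) Fin.zero    eq = ⊥-elim (lookup-apart x∉ i (sym eq))
  lookup-injective (_ ∷ xs!) (Fin.suc i) (Fin.suc j) eq = ≡.cong Fin.suc (lookup-injective xs! i j eq)

  -- Pigeonhole: two entries of `xs` found at the same place of `ys` are equal, so the map of
  -- positions is injective.
  length-mono : ∀ {xs ys} → Unique xs → (∀ {x} → x ∈ xs → x ∈ ys) → length xs ℕ.≤ length ys
  length-mono {xs} {ys} xs! xs⊆ys = Finₚ.injective⇒≤ {f = position} λ {i} {j} eq →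
    lookup-injective xs! i j (trans (at i) (trans (reflexive (≡.cong (lookup ys) eq)) (sym (at j))))
    where
    found : ∀ i → lookup xs i ∈ ys
    found i = xs⊆ys (Membershipₚ.∈-lookup S xs i)
    position : Fin (length xs) → Fin (length ys)
    position i = Any.index (found i)
    at : ∀ i → lookup xs i ≈ lookup ys (position i)
    at i = Anyₚ.lookup-index (found i)

length-cartesianProductWith : {A B C : Set} (f : A → B → C) (xs : List A) (ys : List B) →
  length (cartesianProductWith f xs ys) ≡ length xs ℕ.* length ys
length-cartesianProductWith f []       ys = ≡.refl
length-cartesianProductWith f (x ∷ xs) ys = ≡.trans (Listₚ.length-++ (List.map (f x) ys))
  (≡.cong₂ ℕ._+_ (Listₚ.length-map (f x) ys) (length-cartesianProductWith f xs ys))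

module Cardinality (em : ExcludedMiddle 0ℓ) (ℝ : CompleteOrderedField) where
  open CompleteOrderedField ℝ hiding (zero)
  open Plane ℝ
  open OrderedField ℝ
  open UniqueLists setoid public
  open Membership setoid using (_∈_)

  -- A code stands for at most one real, but there is no algorithm telling whether it stands for
  -- any. Excluded middle keeps its value or drops it, which is why the result is no longer than
  -- `zs`.
  realise : {Code : Set} (R : Code → Carrier → Set) →
    (∀ {z x y} → R z x → R z y → x ≈ y) → (zs : List Code) →
    ∃[ ys ] (length ys ℕ.≤ length zs) × (∀ {x} → Any (λ z → R z x) zs → x ∈ ys)
  realise R functional [] = [] , ℕ.z≤n , λ ()
  realise R functional (z ∷ zs) with realise R functional zs | em {P = ∃ (R z)}
  ... | ys , ys≤zs , covers | yes (y , Rzy) = y ∷ ys , ℕ.s≤s ys≤zs , λ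
    { (here Rzx) → here (functional Rzx Rzy)
    ; (there p)  → there (covers p) }
  ... | ys , ys≤zs , covers | no none = ys , ℕₚ.m≤n⇒m≤1+n ys≤zs , λ
    { (here Rzx) → ⊥-elim (none (_ , Rzx))
    ; (there p)  → covers p }

  decSetoid : DecSetoid 0ℓ 0ℓ
  decSetoid = record { isDecEquivalence = record { isEquivalence = isEquivalence ; _≟_ = _≟_ } }

  cardinality-exists : (A : Carrier → Set) → (∀ {x y} → x ≈ y → A x → A y) →
    (ys : List Carrier) → (∀ {x} → A x → x ∈ ys) → ∃[ N ] (N ℕ.≤ length ys) × HasCardinality A N
  cardinality-exists A resp ys covers = length xs , bound , xs , UniqueDecₚ.deduplicate-! decSetoid kept ,
    (λ x → mk⇔
      (λ x∈xs → proj₂ (Membershipₚ.∈-filter⁻ setoid A? resp {xs = ys}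
        (Membershipₚ.∈-deduplicate⁻ setoid _≟_ kept x∈xs)))
      (λ Ax → Membershipₚ.∈-deduplicate⁺ setoid _≟_ (λ y≈z x≈y → trans x≈y (sym y≈z))
        (Membershipₚ.∈-filter⁺ setoid A? resp (covers Ax) Ax))) ,
    ≡.refl
    where
    A? : ∀ x → Dec (A x)
    A? x = em
    kept xs : List Carrier
    kept = filter A? ys
    xs   = deduplicate _≟_ kept
    bound : length xs ℕ.≤ length ys
    bound = ℕₚ.≤-trans (Listₚ.length-deduplicate _≟_ kept) (Listₚ.length-filter A? ys)

  cardinality-bounded : ∀ {A N} → HasCardinality A N → (ys : List Carrier) → (∀ {x} → A x → x ∈ ys) →
    N ℕ.≤ length ys
  cardinality-bounded (xs , xs! , spec , ≡.refl) ys covers =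
    length-mono xs! (λ x∈xs → covers (Equivalence.to (spec _) x∈xs))

-- Cyclic successors as addition modulo m.

module CyclicSteps (ℝ : CompleteOrderedField) where
  open Plane ℝ using (next)

  steps : ∀ {m} → ℕ → Fin m → Fin m
  steps zero    i = i
  steps (suc d) i = next (steps d i)

  +-%-% : ∀ a b m → (a ℕ.+ b % suc m) % suc m ≡ (a ℕ.+ b) % suc m
  +-%-% a b m = ≡.trans (%-distribˡ-+ a (b % suc m) (suc m))
    (≡.trans (≡.cong (λ c → (a % suc m ℕ.+ c) % suc m) (m%n%n≡m%n b (suc m)))
             (≡.sym (%-distribˡ-+ a b (suc m))))

  toℕ-next : ∀ {m} (i : Fin (suc m)) → toℕ (next i) ≡ suc (toℕ i) % suc m
  toℕ-next {m} i = Finₚ.toℕ-fromℕ< (m%n<n (suc (toℕ i)) (suc m))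

  toℕ-steps : ∀ {m} d (i : Fin (suc m)) → toℕ (steps d i) ≡ (toℕ i ℕ.+ d) % suc m
  toℕ-steps {m} zero    i = ≡.sym (≡.trans (≡.cong (_% suc m) (ℕₚ.+-identityʳ (toℕ i))) (m<n⇒m%n≡m (Finₚ.toℕ<n i)))
  toℕ-steps {m} (suc d) i = ≡.trans (toℕ-next (steps d i))
    (≡.trans (≡.cong (λ a → suc a % suc m) (toℕ-steps d i))
    (≡.trans (+-%-% 1 (toℕ i ℕ.+ d) m) (≡.cong (_% suc m) (≡.sym (ℕₚ.+-suc (toℕ i) d)))))

  steps-reach : ∀ {m} (i j : Fin m) → ∃[ d ] (d ℕ.< m) × (steps d i ≡ j)
  steps-reach {suc m} i j = e % suc m , m%n<n e (suc m) ,
    Finₚ.toℕ-injective (≡.trans (toℕ-steps (e % suc m) i)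
      (≡.trans (+-%-% (toℕ i) e m)
      (≡.trans (≡.cong (_% suc m) lemma)
      (≡.trans ([m+n]%n≡m%n (toℕ j) (suc m)) (m<n⇒m%n≡m (Finₚ.toℕ<n j))))))
    where
    e : ℕ
    -- The difference j - i raised by the modulus `suc m`, so that the truncated subtraction is
    -- exact.
    e = toℕ j ℕ.+ (suc m ∸ toℕ i)
    lemma : toℕ i ℕ.+ e ≡ toℕ j ℕ.+ suc m
    lemma = ≡.trans (≡.sym (ℕₚ.+-assoc (toℕ i) (toℕ j) _))
      (≡.trans (≡.cong (ℕ._+ (suc m ∸ toℕ i)) (ℕₚ.+-comm (toℕ i) (toℕ j)))
      (≡.trans (ℕₚ.+-assoc (toℕ j) (toℕ i) _)
               (≡.cong (toℕ j ℕ.+_) (ℕₚ.m+[n∸m]≡n (ℕₚ.<⇒≤ (Finₚ.toℕ<n i))))))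

  steps-moves : ∀ {m} d (i : Fin m) → 0 ℕ.< d → d ℕ.< m → steps d i ≢ i
  steps-moves {suc m} d i 0<d d<m eq with ℕₚ.<-≤-connex (toℕ i ℕ.+ d) (suc m)
  ... | inj₁ small = ℕₚ.<⇒≢ 0<d (≡.sym (ℕₚ.+-cancelˡ-≡ (toℕ i) d 0
          (≡.trans (≡.sym (m<n⇒m%n≡m small))
          (≡.trans (≡.sym (toℕ-steps d i)) (≡.trans (≡.cong toℕ eq) (≡.sym (ℕₚ.+-identityʳ (toℕ i))))))))
  ... | inj₂ large = ℕₚ.<⇒≢ d<m (ℕₚ.+-cancelˡ-≡ (toℕ i) d (suc m)
          (≡.trans (≡.sym (ℕₚ.m∸n+n≡m large)) (≡.cong (ℕ._+ suc m) wrapped)))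
    where
    remainder<m : toℕ i ℕ.+ d ∸ suc m ℕ.< suc m
    remainder<m = ℕₚ.+-cancelʳ-< (suc m) _ _
      (≡.subst (ℕ._< suc m ℕ.+ suc m) (≡.sym (ℕₚ.m∸n+n≡m large)) (ℕₚ.+-mono-< (Finₚ.toℕ<n i) d<m))
    wrapped : toℕ i ℕ.+ d ∸ suc m ≡ toℕ i
    wrapped = ≡.trans (≡.sym (m<n⇒m%n≡m remainder<m))
      (≡.trans (m≤n⇒[n∸m]%m≡n%m large) (≡.trans (≡.sym (toℕ-steps d i)) (≡.cong toℕ eq)))

-- Chord lengths of a regular polygon.

module RegularPolygons (ℝ : CompleteOrderedField) where
  open CompleteOrderedField ℝ hiding (zero)
  open Plane ℝ
  open IntegerCoefficients commutativeRing
  open OrderedField ℝ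
  open Arccosine ℝ
  open InscribedAngles ℝ
  open CyclicSteps ℝ

  not-parallel : ∀ {u v} → 0# < cross u v → ¬ (proj₁ v ≈ 0# × proj₂ v ≈ 0#)
  not-parallel {x , y} {x′ , y′} 0<uv (x′≈0 , y′≈0) = <⇒≉ 0<uv
    (sym (combine₂ x (- y) y′≈0 x′≈0
      (solve 4 (λ x y x′ y′ → (x :* y′ :- y :* x′) :- con (+ 0)
         := x :* (y′ :- con (+ 0)) :+ (:- y) :* (x′ :- con (+ 0))) refl x y x′ y′)))

  -- A vertex strictly to the left of a side differs from the start of that side. The side starting
  -- at `i` separates `i` from every `j` but `next i`; for that one the side starting at `j` is
  -- used, whose end is not `i` because there are at least 3 vertices.
  vertices-distinct : ∀ {m} {v : Fin m → Point} → IsRegularPolygon v → ∀ i j → i ≢ j → ¬ v i ≈ₚ v j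
  vertices-distinct {v = v} poly i j i≢j vi≈vj with j Finₚ.≟ next i
  ... | no j≢next = not-parallel (convex i j (λ j≡i → i≢j (≡.sym j≡i)) j≢next)
          (≈⇒≈0 (sym (proj₁ vi≈vj)) , ≈⇒≈0 (sym (proj₂ vi≈vj)))
    where open IsRegularPolygon poly
  ... | yes ≡.refl = not-parallel (convex j i i≢j (λ i≡ → steps-moves 2 i (ℕ.s≤s ℕ.z≤n) atLeast3 (≡.sym i≡)))
          (≈⇒≈0 (proj₁ vi≈vj) , ≈⇒≈0 (proj₂ vi≈vj))
    where open IsRegularPolygon poly

  -- The hypotheses force cross b a = ± cross b c. Equal signs would give c = a;
  -- opposite signs make a + c a multiple of b.
  reflection : ∀ {a b c h ρ} → 0# < b · b → a · a ≈ c · c → (b · b) * ρ ≈ 1# →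
    (1# + 1#) * (a · b) ≈ h → (1# + 1#) * (b · c) ≈ h → ¬ c ≈ₚ a →
    (proj₁ c ≈ ρ * h * proj₁ b - proj₁ a) × (proj₂ c ≈ ρ * h * proj₂ b - proj₂ a)
  reflection {a@(a₁ , a₂)} {b@(b₁ , b₂)} {c@(c₁ , c₂)} {h} {ρ} 0<bb aa≈cc bbρ≈1 2ab≈h 2bc≈h c≉a
    = [ (λ k≈0 → ⊥-elim (c≉a (same₁ k≈0 , same₂ k≈0))) , (λ k≈0 → reflected₁ k≈0 , reflected₂ k≈0) ]′
        (*-cancel-zero′ product≈0)
    where
    2≉0 : ¬ 1# + 1# ≈ 0#
    2≉0 = pos⇒≉0 0<2
    -- A difference of squares, which vanishes by Lagrange's identity: `a` and `c` have equal norms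
    -- and equal products with `b`.
    product≈0 : (cross b a - cross b c) * (cross b a + cross b c) ≈ 0#
    product≈0 = combine₂ (b · b) (- (a · b + b · c)) aa≈cc (*-cancelˡ (1# + 1#) 2≉0 (trans 2ab≈h (sym 2bc≈h)))
      (solve 6 (λ a₁ a₂ b₁ b₂ c₁ c₂ →
        ((b₁ :* a₂ :- b₂ :* a₁) :- (b₁ :* c₂ :- b₂ :* c₁)) :* ((b₁ :* a₂ :- b₂ :* a₁) :+ (b₁ :* c₂ :- b₂ :* c₁))
          :- con (+ 0)
        := (b₁ :* b₁ :+ b₂ :* b₂) :* ((a₁ :* a₁ :+ a₂ :* a₂) :- (c₁ :* c₁ :+ c₂ :* c₂))
           :+ (:- ((a₁ :* b₁ :+ a₂ :* b₂) :+ (b₁ :* c₁ :+ b₂ :* c₂)))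
              :* ((a₁ :* b₁ :+ a₂ :* b₂) :- (b₁ :* c₁ :+ b₂ :* c₂)))
        refl a₁ a₂ b₁ b₂ c₁ c₂)
    ab≈bc : a · b ≈ b · c
    ab≈bc = *-cancelˡ (1# + 1#) (pos⇒≉0 0<2) (trans 2ab≈h (sym 2bc≈h))
    same₁ : cross b a - cross b c ≈ 0# → c₁ ≈ a₁
    same₁ k≈0 = *-cancelˡ (b · b) (pos⇒≉0 0<bb) (combine₂ (- b₁) b₂ ab≈bc k≈0
      (solve 6 (λ a₁ a₂ b₁ b₂ c₁ c₂ →
        (b₁ :* b₁ :+ b₂ :* b₂) :* c₁ :- (b₁ :* b₁ :+ b₂ :* b₂) :* a₁
        := (:- b₁) :* ((a₁ :* b₁ :+ a₂ :* b₂) :- (b₁ :* c₁ :+ b₂ :* c₂))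
           :+ b₂ :* (((b₁ :* a₂ :- b₂ :* a₁) :- (b₁ :* c₂ :- b₂ :* c₁)) :- con (+ 0)))
        refl a₁ a₂ b₁ b₂ c₁ c₂))
    same₂ : cross b a - cross b c ≈ 0# → c₂ ≈ a₂
    same₂ k≈0 = *-cancelˡ (b · b) (pos⇒≉0 0<bb) (combine₂ (- b₂) (- b₁) ab≈bc k≈0
      (solve 6 (λ a₁ a₂ b₁ b₂ c₁ c₂ →
        (b₁ :* b₁ :+ b₂ :* b₂) :* c₂ :- (b₁ :* b₁ :+ b₂ :* b₂) :* a₂
        := (:- b₂) :* ((a₁ :* b₁ :+ a₂ :* b₂) :- (b₁ :* c₁ :+ b₂ :* c₂))
           :+ (:- b₁) :* (((b₁ :* a₂ :- b₂ :* a₁) :- (b₁ :* c₂ :- b₂ :* c₁)) :- con (+ 0)))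
        refl a₁ a₂ b₁ b₂ c₁ c₂))
    ab+bc≈h : a · b + b · c ≈ h
    ab+bc≈h = *-cancelˡ (1# + 1#) (pos⇒≉0 0<2) (combine₂ 1# 1# 2ab≈h 2bc≈h
      (solve 3 (λ d e h → con (+ 2) :* (d :+ e) :- con (+ 2) :* h
         := con (+ 1) :* (con (+ 2) :* d :- h) :+ con (+ 1) :* (con (+ 2) :* e :- h)) refl (a · b) (b · c) h))
    reflected₁ : cross b a + cross b c ≈ 0# → c₁ ≈ ρ * h * b₁ - a₁
    reflected₁ k≈0 = *-cancelˡ (b · b) (pos⇒≉0 0<bb) (combine₃ b₁ (- (h * b₁)) (- b₂) ab+bc≈h bbρ≈1 k≈0
      (solve 8 (λ a₁ a₂ b₁ b₂ c₁ c₂ h ρ →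
        (b₁ :* b₁ :+ b₂ :* b₂) :* c₁ :- (b₁ :* b₁ :+ b₂ :* b₂) :* (ρ :* h :* b₁ :- a₁)
        := b₁ :* ((a₁ :* b₁ :+ a₂ :* b₂) :+ (b₁ :* c₁ :+ b₂ :* c₂) :- h)
           :+ (:- (h :* b₁)) :* ((b₁ :* b₁ :+ b₂ :* b₂) :* ρ :- con (+ 1))
           :+ (:- b₂) :* (((b₁ :* a₂ :- b₂ :* a₁) :+ (b₁ :* c₂ :- b₂ :* c₁)) :- con (+ 0)))
        refl a₁ a₂ b₁ b₂ c₁ c₂ h ρ))
    reflected₂ : cross b a + cross b c ≈ 0# → c₂ ≈ ρ * h * b₂ - a₂
    reflected₂ k≈0 = *-cancelˡ (b · b) (pos⇒≉0 0<bb) (combine₃ b₂ (- (h * b₂)) b₁ ab+bc≈h bbρ≈1 k≈0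
      (solve 8 (λ a₁ a₂ b₁ b₂ c₁ c₂ h ρ →
        (b₁ :* b₁ :+ b₂ :* b₂) :* c₂ :- (b₁ :* b₁ :+ b₂ :* b₂) :* (ρ :* h :* b₂ :- a₂)
        := b₂ :* ((a₁ :* b₁ :+ a₂ :* b₂) :+ (b₁ :* c₁ :+ b₂ :* c₂) :- h)
           :+ (:- (h :* b₂)) :* ((b₁ :* b₁ :+ b₂ :* b₂) :* ρ :- con (+ 1))
           :+ b₁ :* (((b₁ :* a₂ :- b₂ :* a₁) :+ (b₁ :* c₂ :- b₂ :* c₁)) :- con (+ 0)))
        refl a₁ a₂ b₁ b₂ c₁ c₂ h ρ))

  module Chords {m} {v : Fin m → Point} (poly : IsRegularPolygon v)
                (o : Point) (r : Carrier) (0<r : 0# < r) (on : ∀ i → IsDistance o (v i) r) where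
    open IsRegularPolygon poly

    s ρ : Carrier
    s = proj₁ equilateral
    ρ = proj₁ (pos-inverse (*-pos 0<r 0<r))

    -- Twice the product ⟨v i - o , v (i + d) - o⟩, which does not depend on i;
    -- the factor 2 avoids a division.
    dot-after : ℕ → Carrier
    dot-after zero          = (1# + 1#) * (r * r)
    dot-after (suc zero)    = (1# + 1#) * (r * r) - s * s
    dot-after (suc (suc d)) = ρ * dot-after 1 * dot-after (suc d) - dot-after d

    arm : Fin m → Point
    arm i = v i -ₚ o

    arm² : ∀ i → arm i · arm i ≈ r * r
    arm² i = sym (proj₂ (on i))

    adjacent : ∀ i → (1# + 1#) * (arm i · arm (next i)) ≈ dot-after 1
    adjacent i = combine₃ 1# 1# 1# (arm² i) (arm² (next i)) (proj₂ (proj₂ equilateral i))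
      (solve 8 (λ p₁ p₂ q₁ q₂ o₁ o₂ r s →
        con (+ 2) :* ((p₁ :- o₁) :* (q₁ :- o₁) :+ (p₂ :- o₂) :* (q₂ :- o₂)) :- (con (+ 2) :* (r :* r) :- s :* s)
        := con (+ 1) :* (((p₁ :- o₁) :* (p₁ :- o₁) :+ (p₂ :- o₂) :* (p₂ :- o₂)) :- r :* r)
           :+ con (+ 1) :* (((q₁ :- o₁) :* (q₁ :- o₁) :+ (q₂ :- o₂) :* (q₂ :- o₂)) :- r :* r)
           :+ con (+ 1) :* (s :* s :- ((q₁ :- p₁) :* (q₁ :- p₁) :+ (q₂ :- p₂) :* (q₂ :- p₂))))
        refl (proj₁ (v i)) (proj₂ (v i)) (proj₁ (v (next i))) (proj₂ (v (next i))) (proj₁ o) (proj₂ o) r s)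

    -- The factor `ρ * dot-after 1` is twice the cosine of the central angle over a side. Equal
    -- radii and equal sides leave a second possibility, that the path turns back to `arm i`;
    -- distinctness of the vertices excludes it.
    arm-recurrence : ∀ i → arm (next (next i)) ≈ₚ
      (ρ * dot-after 1 * proj₁ (arm (next i)) - proj₁ (arm i) ,
       ρ * dot-after 1 * proj₂ (arm (next i)) - proj₂ (arm i))
    arm-recurrence i = reflection (<-respʳ-≈ (sym (arm² (next i))) (*-pos 0<r 0<r))
      (trans (arm² i) (sym (arm² (next (next i)))))
      (trans (*-congʳ (arm² (next i))) (proj₁ (proj₂ (pos-inverse (*-pos 0<r 0<r)))))
      (adjacent i) (adjacent (next i))
      (λ eq → vertices-distinct poly (next (next i)) i (steps-moves 2 i (ℕ.s≤s ℕ.z≤n) atLeast3)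
                (-‿cancelʳ (proj₁ eq) , -‿cancelʳ (proj₂ eq)))

    dot-steps : ∀ d i → (1# + 1#) * (arm i · arm (steps d i)) ≈ dot-after d
    dot-steps zero          i = *-congˡ (arm² i)
    dot-steps (suc zero)    i = adjacent i
    dot-steps (suc (suc d)) i =
      trans (*-congˡ (·-cong {arm i} ≈ₚ-refl (arm-recurrence (steps d i))))
        (combine₂ (ρ * dot-after 1) (- 1#) (dot-steps (suc d) i) (dot-steps d i)
          (solve 9 (λ a₁ a₂ b₁ b₂ c₁ c₂ g t u →
            con (+ 2) :* (a₁ :* (g :* b₁ :- c₁) :+ a₂ :* (g :* b₂ :- c₂)) :- (g :* t :- u)
            := g :* (con (+ 2) :* (a₁ :* b₁ :+ a₂ :* b₂) :- t)
               :+ (:- con (+ 1)) :* (con (+ 2) :* (a₁ :* c₁ :+ a₂ :* c₂) :- u))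
            refl (proj₁ (arm i)) (proj₂ (arm i))
              (proj₁ (arm (next (steps d i)))) (proj₂ (arm (next (steps d i))))
              (proj₁ (arm (steps d i))) (proj₂ (arm (steps d i)))
              (ρ * dot-after 1) (dot-after (suc d)) (dot-after d)))

    chord² : ℕ → Carrier
    chord² d = (1# + 1#) * (r * r) - dot-after d

    chord-steps : ∀ d i → dist² (v i) (v (steps d i)) ≈ chord² d
    chord-steps d i = combine₃ 1# 1# (- 1#) (arm² i) (arm² (steps d i)) (dot-steps d i)
      (solve 8 (λ p₁ p₂ q₁ q₂ o₁ o₂ r t →
        ((q₁ :- p₁) :* (q₁ :- p₁) :+ (q₂ :- p₂) :* (q₂ :- p₂)) :- (con (+ 2) :* (r :* r) :- t)
        := con (+ 1) :* (((p₁ :- o₁) :* (p₁ :- o₁) :+ (p₂ :- o₂) :* (p₂ :- o₂)) :- r :* r)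
           :+ con (+ 1) :* (((q₁ :- o₁) :* (q₁ :- o₁) :+ (q₂ :- o₂) :* (q₂ :- o₂)) :- r :* r)
           :+ (:- con (+ 1)) :* (con (+ 2) :* ((p₁ :- o₁) :* (q₁ :- o₁) :+ (p₂ :- o₂) :* (q₂ :- o₂)) :- t))
        refl (proj₁ (v i)) (proj₂ (v i)) (proj₁ (v (steps d i))) (proj₂ (v (steps d i)))
          (proj₁ o) (proj₂ o) r (dot-after d))

    chord-cases : ∀ i j → Any (dist² (v i) (v j) ≈_) (List.map chord² (upTo m))
    chord-cases i j with steps-reach i j
    ... | d , d<m , ≡.refl = Anyₚ.map⁺ (Any.map at (∈ₚ.∈-upTo⁺ d<m))
      where
      at : ∀ {e} → d ≡ e → dist² (v i) (v (steps d i)) ≈ chord² e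
      at ≡.refl = chord-steps d i

-- The points outside the polygon.

module ImageComplement {m n} (ι : Fin m → Fin n) (ι-injective : ∀ i j → ι i ≡ ι j → i ≡ j) where
  open UniqueLists (≡.setoid (Fin n)) using (length-mono)

  InImage : Fin n → Set
  InImage a = ∃[ i ] ι i ≡ a

  inImage? : ∀ a → Dec (InImage a)
  inImage? a = Finₚ.any? (λ i → ι i Finₚ.≟ a)

  outside : List (Fin n)
  outside = filter (λ a → ¬? (inImage? a)) (allFin n)

  -- The image followed by its complement is a duplicate-free list of indices, so pigeonhole against
  -- `allFin n` applies.
  length-outside : m ℕ.+ length outside ℕ.≤ n
  length-outside = ≡.subst₂ ℕ._≤_
    (≡.trans (Listₚ.length-++ image) (≡.cong (ℕ._+ length outside)
      (≡.trans (Listₚ.length-map ι (allFin m)) (Listₚ.length-tabulate (λ i → i)))))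
    (Listₚ.length-tabulate (λ i → i))
    (length-mono {image ++ outside} {allFin n}
      (Uniqueₚ.++⁺ (Uniqueₚ.map⁺ (ι-injective _ _) (Uniqueₚ.allFin⁺ m))
                   (Uniqueₚ.filter⁺ (λ a → ¬? (inImage? a)) (Uniqueₚ.allFin⁺ n))
                   disjoint)
      (λ {a} _ → ∈ₚ.∈-allFin a))
    where
    image : List (Fin n)
    image = List.map ι (allFin m)
    disjoint : ∀ {a} → ¬ ((a ∈.∈ image) × (a ∈.∈ outside))
    disjoint (a∈image , a∈outside) with ∈ₚ.∈-map⁻ ι a∈image
    ... | i , _ , a≡ιi = proj₂ (∈ₚ.∈-filter⁻ (λ a → ¬? (inImage? a)) {xs = allFin n} a∈outside) (i , ≡.sym a≡ιi)

  cases : ∀ a → InImage a ⊎ (a ∈.∈ outside)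
  cases a with inImage? a
  ... | yes p = inj₁ p
  ... | no ¬p = inj₂ (∈ₚ.∈-filter⁺ (λ a → ¬? (inImage? a)) (∈ₚ.∈-allFin a) ¬p)

-- Angles determined by points on a circle.

module AngleBounds (em : ExcludedMiddle 0ℓ) (ℝ : CompleteOrderedField) where
  open CompleteOrderedField ℝ hiding (zero)
  open Plane ℝ
  open IntegerCoefficients commutativeRing
  open OrderedField ℝ
  open Arccosine ℝ
  open InscribedAngles ℝ
  open RegularPolygons ℝ
  open Cardinality em ℝ
  open Membership setoid using (_∈_)

  determinesAngle-resp : ∀ {n} {P : Fin n → Point} {x y} → x ≈ y → DeterminesAngle P x → DeterminesAngle P y
  determinesAngle-resp x≈y ((i , j , l , i≢j , j≢l , i≢l , c , cosine , arc) , 0<x , π , isπ , x<π) =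
    (i , j , l , i≢j , j≢l , i≢l , c , cosine , arccos-resp x≈y arc) ,
    <-respʳ-≈ x≈y 0<x , π , isπ , <-respˡ-≈ x≈y x<π

  module OnACircle {n} {P : Fin n → Point} (distinct : Distinct P) (onCircle : OnCircle P) where
    o : Point
    o = proj₁ onCircle
    r : Carrier
    r = proj₁ (proj₂ onCircle)
    0<r : 0# < r
    0<r = proj₁ (proj₂ (proj₂ onCircle))
    on : ∀ i → IsDistance o (P i) r
    on = proj₂ (proj₂ (proj₂ onCircle))

    open Circle o r 0<r public

    apart : ∀ {i j} → i ≢ j → ¬ P i ≈ₚ P j
    apart i≢j eq = i≢j (distinct _ _ eq)

    -- By the law of sines a chord determines the inscribed angles over it up
    -- to the sign of their cosine.
    Subtends : (Carrier → Set) → Carrier → Carrier → Set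
    Subtends Side D θ = ∃[ c ] IsArccos c θ × (4r² * (1# - c * c) ≈ D) × Side c

    same-square : ∀ {c c′ D} → 4r² * (1# - c * c) ≈ D → 4r² * (1# - c′ * c′) ≈ D → c * c ≈ c′ * c′
    same-square {c} {c′} e e′ = combine₁ (- 1#) (*-cancelˡ 4r² (pos⇒≉0 0<4r²) (trans e (sym e′)))
      (solve 2 (λ c d → c :* c :- d :* d
         := (:- con (+ 1)) :* ((con (+ 1) :- c :* c) :- (con (+ 1) :- d :* d))) refl c c′)

    subtends⁺-functional : ∀ {D θ θ′} → Subtends (0# ≤_) D θ → Subtends (0# ≤_) D θ′ → θ ≈ θ′
    subtends⁺-functional (c , arc , e , 0≤c) (c′ , arc′ , e′ , 0≤c′) =
      arccos-unique (square-injective 0≤c 0≤c′ (same-square e e′)) arc arc′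

    subtends⁻-functional : ∀ {D θ θ′} → Subtends (_≤ 0#) D θ → Subtends (_≤ 0#) D θ′ → θ ≈ θ′
    subtends⁻-functional (c , arc , e , c≤0) (c′ , arc′ , e′ , c′≤0) =
      arccos-unique (combine₁ (- 1#) (square-injective (nonneg c≤0) (nonneg c′≤0)
          (trans (negate² c) (trans (same-square e e′) (sym (negate² c′)))))
        (solve 2 (λ c d → c :- d := (:- con (+ 1)) :* ((con (+ 0) :- c) :- (con (+ 0) :- d))) refl c c′)) arc arc′
      where
      negate² : ∀ x → (0# - x) * (0# - x) ≈ x * x
      negate² x = solve 1 (λ x → (con (+ 0) :- x) :* (con (+ 0) :- x) := x :* x) refl x

    by-sign : ∀ {D c θ} → IsArccos c θ → 4r² * (1# - c * c) ≈ D → 0# ≤ c ⊎ c ≤ 0# →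
      Subtends (0# ≤_) D θ ⊎ Subtends (_≤ 0#) D θ
    by-sign arc sines (inj₁ 0≤c) = inj₁ (_ , arc , sines , 0≤c)
    by-sign arc sines (inj₂ c≤0) = inj₂ (_ , arc , sines , c≤0)

    angle-subtends : ∀ {i j l θ} → i ≢ j → j ≢ l → IsAngle (P i) (P j) (P l) θ →
      Subtends (0# ≤_) (dist² (P i) (P l)) θ ⊎ Subtends (_≤ 0#) (dist² (P i) (P l)) θ
    angle-subtends {i} {j} {l} i≢j j≢l (c , cosine , arc) =
      by-sign arc (law-of-sines {P i} {P j} {P l} {c} (on i) (on j) (on l)
        (apart i≢j) (apart (λ l≡j → j≢l (≡.sym l≡j))) cosine) (≤-total 0# c)

    -- Each squared length is realised twice, once for acute or right angles and once for obtuse or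
    -- right ones; within each half the cosine, and so the angle, is a function of the length.
    angles-by-chords : (Ds : List Carrier) → (∀ i l → Any (dist² (P i) (P l) ≈_) Ds) →
      ∃[ ys ] (length ys ℕ.≤ length Ds ℕ.+ length Ds) × (∀ {θ} → DeterminesAngle P θ → θ ∈ ys)
    angles-by-chords Ds covers = ys⁺ ++ ys⁻ ,
      ≡.subst (ℕ._≤ length Ds ℕ.+ length Ds) (≡.sym (Listₚ.length-++ ys⁺))
        (ℕₚ.+-mono-≤ (proj₁ (proj₂ real⁺)) (proj₁ (proj₂ real⁻))) ,
      λ ((i , j , l , i≢j , j≢l , _ , angle) , _) →
        [ (λ sub → Anyₚ.++⁺ˡ (proj₂ (proj₂ real⁺) (Any.map (transport sub) (covers i l))))
        , (λ sub → Anyₚ.++⁺ʳ ys⁺ (proj₂ (proj₂ real⁻) (Any.map (transport sub) (covers i l))))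
        ]′ (angle-subtends i≢j j≢l angle)
      where
      real⁺ : ∃[ ys ] (length ys ℕ.≤ length Ds) × (∀ {θ} → Any (λ D → Subtends (0# ≤_) D θ) Ds → θ ∈ ys)
      real⁺ = realise (Subtends (0# ≤_)) subtends⁺-functional Ds
      real⁻ : ∃[ ys ] (length ys ℕ.≤ length Ds) × (∀ {θ} → Any (λ D → Subtends (_≤ 0#) D θ) Ds → θ ∈ ys)
      real⁻ = realise (Subtends (_≤ 0#)) subtends⁻-functional Ds
      ys⁺ ys⁻ : List Carrier
      ys⁺ = proj₁ real⁺
      ys⁻ = proj₁ real⁻
      transport : ∀ {Side D D′ θ} → Subtends Side D θ → D ≈ D′ → Subtends Side D′ θ
      transport (c , arc , sines , side) D≈D′ = c , arc , trans sines D≈D′ , side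

  -- The upper bound.

  module UpperBound {n k} {P : Fin n → Point} (S : 𝒮 n k P) where
    open 𝒮 S
    open OnACircle distinct onCircle

    ι : Fin (n ∸ k) → Fin n
    ι = proj₁ polygon

    open Chords (proj₂ polygon) o r 0<r (λ i → on (ι i))

    ι-injective : ∀ i j → ι i ≡ ι j → i ≡ j
    ι-injective i j eq with i Finₚ.≟ j
    ... | yes i≡j = i≡j
    ... | no i≢j  = ⊥-elim (vertices-distinct (proj₂ polygon) i j i≢j
                      (≡.subst (λ a → P (ι i) ≈ₚ P a) eq ≈ₚ-refl))

    open ImageComplement ι ι-injective

    chords : List Carrier
    chords = List.map chord² (upTo (n ∸ k)) ++
             cartesianProductWith (λ a b → dist² (P a) (P b)) outside (allFin n)

    -- A chord that does not join two vertices has an end in `outside`. The list holds only the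
    -- pairs with that end first; symmetry of `dist²` covers the others.
    chords-cover : ∀ i l → Any (dist² (P i) (P l) ≈_) chords
    chords-cover i l with cases i | cases l
    ... | inj₁ (a , ≡.refl) | inj₁ (b , ≡.refl) = Anyₚ.++⁺ˡ (chord-cases a b)
    ... | inj₂ i∈out        | _                 = Anyₚ.++⁺ʳ _
      (Anyₚ.cartesianProductWith⁺ _ (λ { ≡.refl ≡.refl → refl }) i∈out (∈ₚ.∈-allFin l))
    ... | inj₁ _            | inj₂ l∈out        = Anyₚ.++⁺ʳ _
      (Anyₚ.cartesianProductWith⁺ _ (λ { ≡.refl ≡.refl → dist²-sym (P i) (P l) }) l∈out (∈ₚ.∈-allFin i))

    -- The hypothesis `1 ≤ k` lets `n * k` also bound the at most `n` lengths coming from the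
    -- polygon.
    length-chords : k ℕ.≤ n → 1 ℕ.≤ k → length chords ℕ.≤ 2 ℕ.* (n ℕ.* k)
    length-chords k≤n 1≤k = begin
      length chords
        ≡⟨ Listₚ.length-++ (List.map chord² (upTo m)) ⟩
      length (List.map chord² (upTo m)) ℕ.+ length (cartesianProductWith (λ a b → dist² (P a) (P b)) outside (allFin n))
        ≡⟨ ≡.cong₂ ℕ._+_ (≡.trans (Listₚ.length-map chord² (upTo m)) (Listₚ.length-upTo m))
             (≡.trans (length-cartesianProductWith (λ a b → dist² (P a) (P b)) outside (allFin n))
                      (≡.cong (length outside ℕ.*_) (Listₚ.length-tabulate (λ i → i)))) ⟩
      m ℕ.+ length outside ℕ.* n
        ≤⟨ ℕₚ.+-mono-≤ m≤nk (ℕₚ.*-monoˡ-≤ n out≤k) ⟩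
      n ℕ.* k ℕ.+ k ℕ.* n
        ≡⟨ N.solve 2 (λ n k → n N.:* k N.:+ k N.:* n N.:= N.con 2 N.:* (n N.:* k)) ≡.refl n k ⟩
      2 ℕ.* (n ℕ.* k) ∎
      where
      open ℕₚ.≤-Reasoning
      module N = +-*-Solver
      m : ℕ
      m = n ∸ k
      m≤nk : m ℕ.≤ n ℕ.* k
      m≤nk = ℕₚ.≤-trans (ℕₚ.m∸n≤m n k) (ℕₚ.m≤m*n n k {{ℕ.>-nonZero 1≤k}})
      out≤k : length outside ℕ.≤ k
      out≤k = ℕₚ.+-cancelˡ-≤ m _ _ (≡.subst (m ℕ.+ length outside ℕ.≤_) (≡.sym (ℕₚ.m∸n+n≡m k≤n)) length-outside)

    angles : k ℕ.≤ n → 1 ℕ.≤ k →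
      ∃[ ys ] (length ys ℕ.≤ 4 ℕ.* (n ℕ.* k)) × (∀ {θ} → DeterminesAngle P θ → θ ∈ ys)
    angles k≤n 1≤k = proj₁ found , ℕₚ.≤-trans (proj₁ (proj₂ found)) (ℕₚ.≤-trans
        (ℕₚ.+-mono-≤ (length-chords k≤n 1≤k) (length-chords k≤n 1≤k))
        (ℕₚ.≤-reflexive (≡.sym (ℕₚ.*-distribʳ-+ (n ℕ.* k) 2 2)))) , proj₂ (proj₂ found)
      where
      found : ∃[ ys ] (length ys ℕ.≤ length chords ℕ.+ length chords) × (∀ {θ} → DeterminesAngle P θ → θ ∈ ys)
      found = angles-by-chords chords chords-cover

  -- The lower bound.

  half-plane : Carrier → Fin 2
  half-plane x with 0# ≤? x
  ... | yes _ = Fin.zero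
  ... | no _  = Fin.suc Fin.zero

  -- The code is a sign bit, which a square forgets. It lies in `Fin 2` so that it can be paired
  -- with a list position inside one `Fin`.
  half-plane-injective : ∀ {x y} → half-plane x ≡ half-plane y → x * x ≈ y * y → x ≈ y
  half-plane-injective {x} {y} same xx≈yy with 0# ≤? x | 0# ≤? y
  ... | yes 0≤x | yes 0≤y = square-injective 0≤x 0≤y xx≈yy
  ... | no x≱0  | no y≱0  = combine₁ (- 1#)
    (square-injective (<⇒≤ (neg⇒pos (≰⇒> x≱0))) (<⇒≤ (neg⇒pos (≰⇒> y≱0)))
      (trans (solve 1 (λ x → (:- x) :* (:- x) := x :* x) refl x)
        (trans xx≈yy (solve 1 (λ x → x :* x := (:- x) :* (:- x)) refl y))))
    (solve 2 (λ x y → x :- y := (:- con (+ 1)) :* ((:- x) :- (:- y))) refl x y)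
  ... | yes _ | no _ with () ← same
  ... | no _ | yes _ with () ← same

  -- Equal norms and distances give `a · b ≈ a · c`, hence equal squares of the cross products by
  -- Lagrange's identity, and the sign bit makes the cross products themselves equal. The two
  -- products with `a` determine a vector, as `a` is nonzero.
  same-side : ∀ {a b c} → 0# < a · a → b · b ≈ a · a → c · c ≈ a · a → dist² a b ≈ dist² a c →
    half-plane (cross a b) ≡ half-plane (cross a c) → b ≈ₚ c
  same-side {a@(a₁ , a₂)} {b@(b₁ , b₂)} {c@(c₁ , c₂)} 0<aa bb≈aa cc≈aa ab≈ac side = same₁ , same₂
    where
    dots : a · b ≈ a · c
    dots = *-cancelˡ (1# + 1#) (pos⇒≉0 0<2) (combine₃ 1# (- 1#) (- 1#) bb≈aa cc≈aa ab≈ac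
      (solve 6 (λ a₁ a₂ b₁ b₂ c₁ c₂ →
        con (+ 2) :* (a₁ :* b₁ :+ a₂ :* b₂) :- con (+ 2) :* (a₁ :* c₁ :+ a₂ :* c₂)
        := con (+ 1) :* ((b₁ :* b₁ :+ b₂ :* b₂) :- (a₁ :* a₁ :+ a₂ :* a₂))
           :+ (:- con (+ 1)) :* ((c₁ :* c₁ :+ c₂ :* c₂) :- (a₁ :* a₁ :+ a₂ :* a₂))
           :+ (:- con (+ 1)) :* (((b₁ :- a₁) :* (b₁ :- a₁) :+ (b₂ :- a₂) :* (b₂ :- a₂))
                                 :- ((c₁ :- a₁) :* (c₁ :- a₁) :+ (c₂ :- a₂) :* (c₂ :- a₂))))
        refl a₁ a₂ b₁ b₂ c₁ c₂))
    crosses : cross a b ≈ cross a c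
    crosses = half-plane-injective side (combine₃ (a · a) (- (a · a)) (- (a · b + a · c)) bb≈aa cc≈aa dots
      (solve 6 (λ a₁ a₂ b₁ b₂ c₁ c₂ →
        (a₁ :* b₂ :- a₂ :* b₁) :* (a₁ :* b₂ :- a₂ :* b₁) :- (a₁ :* c₂ :- a₂ :* c₁) :* (a₁ :* c₂ :- a₂ :* c₁)
        := (a₁ :* a₁ :+ a₂ :* a₂) :* ((b₁ :* b₁ :+ b₂ :* b₂) :- (a₁ :* a₁ :+ a₂ :* a₂))
           :+ (:- (a₁ :* a₁ :+ a₂ :* a₂)) :* ((c₁ :* c₁ :+ c₂ :* c₂) :- (a₁ :* a₁ :+ a₂ :* a₂))
           :+ (:- ((a₁ :* b₁ :+ a₂ :* b₂) :+ (a₁ :* c₁ :+ a₂ :* c₂)))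
              :* ((a₁ :* b₁ :+ a₂ :* b₂) :- (a₁ :* c₁ :+ a₂ :* c₂)))
        refl a₁ a₂ b₁ b₂ c₁ c₂))
    same₁ : b₁ ≈ c₁
    same₁ = *-cancelˡ (a · a) (pos⇒≉0 0<aa) (combine₂ a₁ (- a₂) dots crosses
      (solve 6 (λ a₁ a₂ b₁ b₂ c₁ c₂ →
        (a₁ :* a₁ :+ a₂ :* a₂) :* b₁ :- (a₁ :* a₁ :+ a₂ :* a₂) :* c₁
        := a₁ :* ((a₁ :* b₁ :+ a₂ :* b₂) :- (a₁ :* c₁ :+ a₂ :* c₂))
           :+ (:- a₂) :* ((a₁ :* b₂ :- a₂ :* b₁) :- (a₁ :* c₂ :- a₂ :* c₁)))
        refl a₁ a₂ b₁ b₂ c₁ c₂))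
    same₂ : b₂ ≈ c₂
    same₂ = *-cancelˡ (a · a) (pos⇒≉0 0<aa) (combine₂ a₂ a₁ dots crosses
      (solve 6 (λ a₁ a₂ b₁ b₂ c₁ c₂ →
        (a₁ :* a₁ :+ a₂ :* a₂) :* b₂ :- (a₁ :* a₁ :+ a₂ :* a₂) :* c₂
        := a₂ :* ((a₁ :* b₁ :+ a₂ :* b₂) :- (a₁ :* c₁ :+ a₂ :* c₂))
           :+ a₁ :* ((a₁ :* b₂ :- a₂ :* b₁) :- (a₁ :* c₂ :- a₂ :* c₁)))
        refl a₁ a₂ b₁ b₂ c₁ c₂))

  module LowerBound {n} {P : Fin (3 ℕ.+ n) → Point} (distinct : Distinct P) (onCircle : OnCircle P)
                    {N} (count : AngleCount P N) where
    open OnACircle distinct onCircle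

    -- The chord from point 0 to point `suc l` needs a third point to be seen from: point 1, or
    -- point 2 when the chord ends at point 1.
    apex : Fin (2 ℕ.+ n) → Fin (3 ℕ.+ n)
    apex Fin.zero    = Fin.suc (Fin.suc Fin.zero)
    apex (Fin.suc _) = Fin.suc Fin.zero

    0≢apex : ∀ l → Fin.zero ≢ apex l
    0≢apex Fin.zero    ()
    0≢apex (Fin.suc _) ()

    apex≢ : ∀ l → apex l ≢ Fin.suc l
    apex≢ Fin.zero    ()
    apex≢ (Fin.suc _) ()

    angle : ∀ l → InscribedAngle (P Fin.zero) (P (apex l)) (P (Fin.suc l))
    angle l = inscribed-angle (on Fin.zero) (on (apex l)) (on (Fin.suc l))
      (apart (0≢apex l)) (apart (λ eq → apex≢ l (≡.sym eq))) (apart λ ())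

    module Angle l = InscribedAngle (angle l)

    determined : ∀ l → DeterminesAngle P (Angle.θ l)
    determined l = (Fin.zero , apex l , Fin.suc l , 0≢apex l , apex≢ l , (λ ()) ,
        Angle.c l , Angle.cosine l , Angle.arccos l) , Angle.positive l , Angle.below-π l

    listed : ∀ l → Angle.θ l ∈ proj₁ count
    listed l = Equivalence.from (proj₁ (proj₂ (proj₂ count)) _) (determined l)

    arm : Fin (3 ℕ.+ n) → Point
    arm i = P i -ₚ o

    position : Fin (2 ℕ.+ n) → Fin (length (proj₁ count))
    position l = Any.index (listed l)

    side : Fin (2 ℕ.+ n) → Fin 2
    side l = half-plane (cross (arm Fin.zero) (arm (Fin.suc l)))

    code : Fin (2 ℕ.+ n) → Fin (length (proj₁ count) ℕ.* 2)
    code l = combine (position l) (side l)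

    same-angle : ∀ l l′ → position l ≡ position l′ → Angle.θ l ≈ Angle.θ l′
    same-angle l l′ eq = trans (Anyₚ.lookup-index (listed l))
      (trans (reflexive (≡.cong (lookup (proj₁ count)) eq)) (sym (Anyₚ.lookup-index (listed l′))))

    same-chord : ∀ l l′ → position l ≡ position l′ →
      dist² (P Fin.zero) (P (Fin.suc l)) ≈ dist² (P Fin.zero) (P (Fin.suc l′))
    same-chord l l′ eq = trans (sym (Angle.sines l)) (trans
      (*-congˡ (+-congˡ (-‿cong (*-cong c≈c′ c≈c′)))) (Angle.sines l′))
      where
      c≈c′ : Angle.c l ≈ Angle.c l′
      c≈c′ = arccos-injective (<⇒≤ (Angle.proper l)) (<⇒≤ (Angle.proper l′))
               (Angle.arccos l) (Angle.arccos l′) (same-angle l l′ eq)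

    arm² : ∀ i → arm i · arm i ≈ r * r
    arm² i = sym (proj₂ (on i))

    centred-distance : ∀ i j → dist² (arm i) (arm j) ≈ dist² (P i) (P j)
    centred-distance i j = solve 6 (λ p₁ p₂ q₁ q₂ o₁ o₂ →
        ((q₁ :- o₁) :- (p₁ :- o₁)) :* ((q₁ :- o₁) :- (p₁ :- o₁)) :+ ((q₂ :- o₂) :- (p₂ :- o₂)) :* ((q₂ :- o₂) :- (p₂ :- o₂))
        := (q₁ :- p₁) :* (q₁ :- p₁) :+ (q₂ :- p₂) :* (q₂ :- p₂))
      refl (proj₁ (P i)) (proj₂ (P i)) (proj₁ (P j)) (proj₂ (P j)) (proj₁ o) (proj₂ o)

    -- Equal positions mean equal angles, so equal cosines as arccos is injective, so equal chords
    -- from point 0; the side bit then separates the two possible far ends.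
    code-injective : ∀ {l l′} → code l ≡ code l′ → l ≡ l′
    code-injective {l} {l′} eq = Finₚ.suc-injective (distinct (Fin.suc l) (Fin.suc l′)
      (-‿cancelʳ (proj₁ arms) , -‿cancelʳ (proj₂ arms)))
      where
      parts : position l ≡ position l′ × side l ≡ side l′
      parts = Finₚ.combine-injective (position l) (side l) (position l′) (side l′) eq
      arms : arm (Fin.suc l) ≈ₚ arm (Fin.suc l′)
      arms = same-side {arm Fin.zero} (<-respʳ-≈ (sym (arm² Fin.zero)) (*-pos 0<r 0<r))
        (trans (arm² (Fin.suc l)) (sym (arm² Fin.zero)))
        (trans (arm² (Fin.suc l′)) (sym (arm² Fin.zero)))
        (trans (centred-distance _ _) (trans (same-chord l l′ (proj₁ parts)) (sym (centred-distance _ _))))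
        (proj₂ parts)

    -- Injectivity of the code gives `2 + n ≤ 2 * N`, whence `N` is at least 1 and pays for the
    -- remaining point: `3 + n ≤ 1 + 2 * N ≤ 3 * N`.
    many-angles : 3 ℕ.+ n ℕ.≤ 3 ℕ.* N
    many-angles = bound N (≡.subst (λ M → 2 ℕ.+ n ℕ.≤ M ℕ.* 2) (proj₂ (proj₂ (proj₂ count)))
      (Finₚ.injective⇒≤ code-injective))
      where
      bound : ∀ M → 2 ℕ.+ n ℕ.≤ M ℕ.* 2 → 3 ℕ.+ n ℕ.≤ 3 ℕ.* M
      bound (suc M) h = ℕₚ.≤-trans (ℕ.s≤s h) (ℕₚ.≤-trans (ℕₚ.+-monoˡ-≤ (suc M ℕ.* 2) (ℕ.s≤s (ℕ.z≤n {M})))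
        (ℕₚ.≤-reflexive (N.solve 1 (λ x → x N.:+ x N.:* N.con 2 N.:= N.con 3 N.:* x) ≡.refl (suc M))))
        where module N = +-*-Solver

-- The largest roots of the Chebyshev polynomials of the second kind.

module Chebyshev (ℝ : CompleteOrderedField) where
  open CompleteOrderedField ℝ hiding (zero)
  open IntegerCoefficients commutativeRing
  open OrderedField ℝ
  open RealRoots ℝ

  -- The Lipschitz property alone is not preserved by the factor `x + x` of the recurrence: the
  -- change of 2x f(x) involves the size of f as well. A bound `B` on the absolute value is
  -- therefore carried along.
  record Tame (f : Carrier → Carrier) : Set where
    field
      L B       : Carrier
      0<L       : 0# < L
      0<B       : 0# < B
      lipschitz : Lipschitz 0# 1# L f
      below     : ∀ {x} → 0# ≤ x → x ≤ 1# → - B ≤ f x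
      above     : ∀ {x} → 0# ≤ x → x ≤ 1# → f x ≤ B

  constant-tame : ∀ {c} → - 1# ≤ c → c ≤ 1# → Tame (λ _ → c)
  constant-tame {c} -1≤c c≤1 = record
    { L = 1# ; B = 1# ; 0<L = 0<1 ; 0<B = 0<1
    ; lipschitz = λ _ x≤y _ → flat x≤y , flat x≤y
    ; below = λ _ _ → -1≤c ; above = λ _ _ → c≤1 }
    where
    flat : ∀ {x y} → x ≤ y → c - c ≤ 1# * (y - x)
    flat {x} {y} x≤y = ≤-by (nonneg x≤y)
      (solve 3 (λ c x y → con (+ 1) :* (y :- x) :- (c :- c) := y :- x) refl c x y)

  recurrence-tame : ∀ {f g} → Tame f → Tame g → Tame (λ x → (x + x) * f x - g x)
  recurrence-tame {f} {g} F G = record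
    { L = (f.L + f.L) + (f.B + f.B) + g.L
    ; B = (f.B + f.B) + g.B
    ; 0<L = +-pos (+-pos (+-pos f.0<L (<⇒≤ f.0<L)) (<⇒≤ (+-pos f.0<B (<⇒≤ f.0<B)))) (<⇒≤ g.0<L)
    ; 0<B = +-pos (+-pos f.0<B (<⇒≤ f.0<B)) (<⇒≤ g.0<B)
    ; lipschitz = lip
    ; below = λ {x} 0≤x x≤1 → ≤-by
        (+-nonneg (+-nonneg (*-nonneg (+-nonneg 0≤x 0≤x) (nonneg (f.below 0≤x x≤1)))
                            (*-nonneg (+-nonneg (nonneg x≤1) (nonneg x≤1)) (<⇒≤ f.0<B)))
                  (nonneg (g.above 0≤x x≤1)))
        (solve 5 (λ x f g B B′ → ((x :+ x) :* f :- g) :- (:- (B :+ B :+ B′))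
           := ((x :+ x) :* (f :- (:- B)) :+ ((con (+ 1) :- x) :+ (con (+ 1) :- x)) :* B) :+ (B′ :- g))
           refl x (f x) (g x) f.B g.B)
    ; above = λ {x} 0≤x x≤1 → ≤-by
        (+-nonneg (+-nonneg (*-nonneg (+-nonneg 0≤x 0≤x) (nonneg (f.above 0≤x x≤1)))
                            (*-nonneg (+-nonneg (nonneg x≤1) (nonneg x≤1)) (<⇒≤ f.0<B)))
                  (nonneg (g.below 0≤x x≤1)))
        (solve 5 (λ x f g B B′ → (B :+ B :+ B′) :- ((x :+ x) :* f :- g)
           := ((x :+ x) :* (B :- f) :+ ((con (+ 1) :- x) :+ (con (+ 1) :- x)) :* B) :+ (g :- (:- B′)))
           refl x (f x) (g x) f.B g.B) }
    where
    module f = Tame F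
    module g = Tame G
    lip : Lipschitz 0# 1# ((f.L + f.L) + (f.B + f.B) + g.L) (λ x → (x + x) * f x - g x)
    lip {x} {y} 0≤x x≤y y≤1 =
      ≤-by (+-nonneg (+-nonneg (+-nonneg
              (*-nonneg (+-nonneg 0≤y 0≤y) (nonneg (proj₁ (f.lipschitz 0≤x x≤y y≤1)))) slack)
              (*-nonneg 0≤2Δ (nonneg (f.above 0≤x x≤1))))
              (nonneg (proj₂ (g.lipschitz 0≤x x≤y y≤1))))
        (solve 9 (λ x y fx fy gx gy L B L′ →
          (L :+ L :+ (B :+ B) :+ L′) :* (y :- x) :- (((y :+ y) :* fy :- gy) :- ((x :+ x) :* fx :- gx))
          := ((y :+ y) :* (L :* (y :- x) :- (fy :- fx))
              :+ ((con (+ 1) :- y) :+ (con (+ 1) :- y)) :* (L :* (y :- x))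
              :+ ((y :- x) :+ (y :- x)) :* (B :- fx))
             :+ (L′ :* (y :- x) :- (gx :- gy)))
          refl x y (f x) (f y) (g x) (g y) f.L f.B g.L) ,
      ≤-by (+-nonneg (+-nonneg (+-nonneg
              (*-nonneg (+-nonneg 0≤y 0≤y) (nonneg (proj₂ (f.lipschitz 0≤x x≤y y≤1)))) slack)
              (*-nonneg 0≤2Δ (nonneg (f.below 0≤x x≤1))))
              (nonneg (proj₁ (g.lipschitz 0≤x x≤y y≤1))))
        (solve 9 (λ x y fx fy gx gy L B L′ →
          (L :+ L :+ (B :+ B) :+ L′) :* (y :- x) :- (((x :+ x) :* fx :- gx) :- ((y :+ y) :* fy :- gy))
          := ((y :+ y) :* (L :* (y :- x) :- (fx :- fy))
              :+ ((con (+ 1) :- y) :+ (con (+ 1) :- y)) :* (L :* (y :- x))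
              :+ ((y :- x) :+ (y :- x)) :* (fx :- (:- B)))
             :+ (L′ :* (y :- x) :- (gy :- gx)))
          refl x y (f x) (f y) (g x) (g y) f.L f.B g.L)
      where
      0≤y : 0# ≤ y
      0≤y = ≤-trans 0≤x x≤y
      x≤1 : x ≤ 1#
      x≤1 = ≤-trans x≤y y≤1
      0≤2Δ : 0# ≤ (y - x) + (y - x)
      0≤2Δ = +-nonneg (nonneg x≤y) (nonneg x≤y)
      -- What is lost when the factor `y + y` in front of the change of `f` is replaced by its bound
      -- 2.
      slack : 0# ≤ ((1# - y) + (1# - y)) * (f.L * (y - x))
      slack = *-nonneg (+-nonneg (nonneg y≤1) (nonneg y≤1)) (*-nonneg (<⇒≤ f.0<L) (nonneg x≤y))

  -- U d (cos t) = sin (d t) / sin t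
  U : ℕ → Carrier → Carrier
  U zero          x = 0#
  U (suc zero)    x = 1#
  U (suc (suc d)) x = (x + x) * U (suc d) x - U d x

  U-cong : ∀ d → U d Preserves _≈_ ⟶ _≈_
  U-cong zero          x≈y = refl
  U-cong (suc zero)    x≈y = refl
  U-cong (suc (suc d)) x≈y = +-cong (*-cong (+-cong x≈y x≈y) (U-cong (suc d) x≈y)) (-‿cong (U-cong d x≈y))

  U-tame : ∀ d → Tame (U d)
  U-tame zero          = constant-tame (≤-by 0≤1 (solve 0 (con (+ 0) :- (:- con (+ 1)) := con (+ 1)) refl)) 0≤1
  U-tame (suc zero)    = constant-tame (≤-by (<⇒≤ 0<2) (solve 0 (con (+ 1) :- (:- con (+ 1)) := con (+ 2)) refl)) ≤-refl
  U-tame (suc (suc d)) = recurrence-tame (U-tame (suc d)) (U-tame d)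

  -- In effect U d 1 = d; at 1 the recurrence says that consecutive differences are constant.
  U-at-1-step : ∀ d → U (suc d) 1# - U d 1# ≈ 1#
  U-at-1-step zero    = solve 0 (con (+ 1) :- con (+ 0) := con (+ 1)) refl
  U-at-1-step (suc d) = trans
    (solve 2 (λ u v → (con (+ 2) :* u :- v) :- u := u :- v) refl (U (suc d) 1#) (U d 1#)) (U-at-1-step d)

  U-at-1-pos : ∀ d → 0# < U (suc d) 1#
  U-at-1-pos zero    = 0<1
  U-at-1-pos (suc d) = <-trans (U-at-1-pos d) (<-by 0<1 (U-at-1-step (suc d)))

  -- t is cos (π / (e + 2)).
  record LargestRoot (e : ℕ) : Set where
    field
      t        : Carrier
      0≤t      : 0# ≤ t
      t<1      : t < 1#
      root     : U (2 ℕ.+ e) t ≈ 0#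
      positive : ∀ j → j ℕ.≤ e → 0# < U (suc j) t
      beyond   : ∀ {x} → t < x → x ≤ 1# → ∀ j → j ℕ.≤ suc e → 0# < U (suc j) x

  -- At the largest root t of U (e + 2) the recurrence gives U (e + 3) t = - U (e + 1) t, which is
  -- negative, while U (e + 3) is positive at 1. Its last zero thus lies strictly between t and 1,
  -- where `beyond` for t makes all lower polynomials positive. The induction starts from U 2 x =
  -- 2x, with root 0.
  largestRoot : ∀ e → LargestRoot e
  largestRoot zero = record
    { t = 0# ; 0≤t = ≤-refl ; t<1 = 0<1
    ; root = solve 0 ((con (+ 0) :+ con (+ 0)) :* con (+ 1) :- con (+ 0) := con (+ 0)) refl
    ; positive = λ { zero _ → 0<1 }
    ; beyond = λ { 0<x _ zero _ → 0<1
                 ; 0<x _ (suc zero) _ → <-by (+-pos 0<x (<⇒≤ 0<x))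
                     (solve 1 (λ x → ((x :+ x) :* con (+ 1) :- con (+ 0)) :- con (+ 0) := x :+ x) refl _)
                 ; _ _ (suc (suc _)) (ℕ.s≤s ()) } }
  largestRoot (suc e) = record
    { t = t′ ; 0≤t = ≤-trans R.0≤t t≤t′ ; t<1 = proj₁ (proj₂ (proj₂ found)) ; root = root′
    ; positive = R.beyond t<t′ (<⇒≤ (proj₁ (proj₂ (proj₂ found))))
    ; beyond = λ {x} t′<x x≤1 j j≤ →
        [ (λ j<2+e → R.beyond (<-trans t<t′ t′<x) x≤1 j (ℕ.s≤s⁻¹ j<2+e))
        , (λ { ≡.refl → proj₂ (proj₂ (proj₂ (proj₂ found))) t′<x x≤1 }) ]′ (ℕₚ.m≤n⇒m<n∨m≡n j≤) }
    where
    module R = LargestRoot (largestRoot e)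
    f : Carrier → Carrier
    f = U (3 ℕ.+ e)

    ft<0 : f R.t < 0#
    ft<0 = <-by (R.positive e ℕₚ.≤-refl) (combine₁ (- (R.t + R.t)) R.root
      (solve 3 (λ t u v → con (+ 0) :- ((t :+ t) :* u :- v) :- v := (:- (t :+ t)) :* (u :- con (+ 0)))
        refl R.t (U (2 ℕ.+ e) R.t) (U (suc e) R.t)))

    lip : Lipschitz R.t 1# (Tame.L (U-tame (3 ℕ.+ e))) f
    lip t≤x = Tame.lipschitz (U-tame (3 ℕ.+ e)) (≤-trans R.0≤t t≤x)

    found : ∃[ s ] (R.t ≤ s) × (s < 1#) × (f s ≈ 0#) × (∀ {x} → s < x → x ≤ 1# → 0# < f x)
    found = last-zero (U-cong (3 ℕ.+ e)) (Tame.0<L (U-tame (3 ℕ.+ e))) lip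
              (<⇒≤ R.t<1) (<⇒≤ ft<0) (U-at-1-pos (2 ℕ.+ e))

    t′ : Carrier
    t′ = proj₁ found
    t≤t′ : R.t ≤ t′
    t≤t′ = proj₁ (proj₂ found)
    root′ : f t′ ≈ 0#
    root′ = proj₁ (proj₂ (proj₂ (proj₂ found)))

    t<t′ : R.t < t′
    t<t′ = ≰⇒> λ t′≤t → <⇒≉ ft<0 (trans (U-cong (3 ℕ.+ e) (≤-antisym t≤t′ t′≤t)) root′)

-- Existence of regular polygons.

module PolygonExistence (ℝ : CompleteOrderedField) where
  open CompleteOrderedField ℝ hiding (zero)
  open Plane ℝ
  open IntegerCoefficients commutativeRing
  open OrderedField ℝ
  open Arccosine ℝ
  open InscribedAngles ℝ
  open CyclicSteps ℝ
  open Chebyshev ℝ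

  infixl 7 _⊗_

  -- Multiplication of points read as complex numbers.
  _⊗_ : Point → Point → Point
  (x , y) ⊗ (a , b) = (x * a - y * b , x * b + y * a)

  square : Point → Point
  square u = u ⊗ u

  ⊗-congˡ : ∀ {u v w} → v ≈ₚ w → (u ⊗ v) ≈ₚ (u ⊗ w)
  ⊗-congˡ (e , f) = +-cong (*-congˡ e) (-‿cong (*-congˡ f)) , +-cong (*-congˡ f) (*-congˡ e)

  ⊗-congʳ : ∀ {u v w} → v ≈ₚ w → (v ⊗ u) ≈ₚ (w ⊗ u)
  ⊗-congʳ (e , f) = +-cong (*-congʳ e) (-‿cong (*-congʳ f)) , +-cong (*-congʳ e) (*-congʳ f)

  ⊗-assoc : ∀ u v w → (u ⊗ (v ⊗ w)) ≈ₚ ((u ⊗ v) ⊗ w)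
  ⊗-assoc (a , b) (c , d) (e , f) =
    solve 6 (λ a b c d e f → a :* (c :* e :- d :* f) :- b :* (c :* f :+ d :* e)
      := (a :* c :- b :* d) :* e :- (a :* d :+ b :* c) :* f) refl a b c d e f ,
    solve 6 (λ a b c d e f → a :* (c :* f :+ d :* e) :+ b :* (c :* e :- d :* f)
      := (a :* c :- b :* d) :* f :+ (a :* d :+ b :* c) :* e) refl a b c d e f

  square-⊗ : ∀ u v → square (u ⊗ v) ≈ₚ (square u ⊗ square v)
  square-⊗ (a , b) (c , d) =
    solve 4 (λ a b c d → (a :* c :- b :* d) :* (a :* c :- b :* d) :- (a :* d :+ b :* c) :* (a :* d :+ b :* c)
      := (a :* a :- b :* b) :* (c :* c :- d :* d) :- (a :* b :+ b :* a) :* (c :* d :+ d :* c)) refl a b c d ,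
    solve 4 (λ a b c d → (a :* c :- b :* d) :* (a :* d :+ b :* c) :+ (a :* d :+ b :* c) :* (a :* c :- b :* d)
      := (a :* a :- b :* b) :* (c :* d :+ d :* c) :+ (a :* b :+ b :* a) :* (c :* c :- d :* d)) refl a b c d

  Unit : Point → Set
  Unit u = u · u ≈ 1#

  ⊗-unit : ∀ {u v} → Unit u → Unit v → Unit (u ⊗ v)
  ⊗-unit {a , b} {c , d} hu hv = combine₂ (c * c + d * d) 1# hu hv
    (solve 4 (λ a b c d →
      ((a :* c :- b :* d) :* (a :* c :- b :* d) :+ (a :* d :+ b :* c) :* (a :* d :+ b :* c)) :- con (+ 1)
      := (c :* c :+ d :* d) :* (a :* a :+ b :* b :- con (+ 1)) :+ con (+ 1) :* (c :* c :+ d :* d :- con (+ 1)))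
      refl a b c d)

  origin one : Point
  origin = (0# , 0#)
  one    = (1# , 0#)

  one-⊗ : ∀ u → (one ⊗ u) ≈ₚ u
  one-⊗ (a , b) =
    solve 2 (λ a b → con (+ 1) :* a :- con (+ 0) :* b := a) refl a b ,
    solve 2 (λ a b → con (+ 1) :* b :+ con (+ 0) :* a := b) refl a b

  on-unit-circle : ∀ {u} → Unit u → IsDistance origin u 1#
  on-unit-circle {a , b} hu = 0≤1 , combine₁ (- 1#) hu
    (solve 2 (λ a b → con (+ 1) :* con (+ 1) :- ((a :- con (+ 0)) :* (a :- con (+ 0)) :+ (b :- con (+ 0)) :* (b :- con (+ 0)))
      := (:- con (+ 1)) :* (a :* a :+ b :* b :- con (+ 1))) refl a b)

  cosine-transfer : ∀ {u v u′ v′ c} → u · u ≈ u′ · u′ → v · v ≈ v′ · v′ → u · v ≈ u′ · v′ →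
    IsCosine u v c → IsCosine u′ v′ c
  cosine-transfer uu vv uv (s , t , (0≤s , ss≈) , (0≤t , tt≈) , eq) =
    s , t , (0≤s , trans ss≈ uu) , (0≤t , trans tt≈ vv) , trans eq uv

  cross-cong : ∀ {u v u′ v′} → u ≈ₚ u′ → v ≈ₚ v′ → cross u v ≈ cross u′ v′
  cross-cong (e , f) (e′ , f′) = +-cong (*-cong e f′) (-‿cong (*-cong f e′))

  -- The vertices are the powers of z², where z = exp (i π / m) has the
  -- largest root of U m as its abscissa.
  module Polygon (e : ℕ) where
    m : ℕ
    m = 3 ℕ.+ e

    -- `LargestRoot e` concerns `U (2 + e)`, so index `suc e` yields the root of `U m`.
    open LargestRoot (largestRoot (suc e)) renaming (t to x; 0≤t to 0≤x; t<1 to x<1)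

    0<1-x² : 0# < 1# - x * x
    0<1-x² = <-by (*-pos (pos x<1) (+-pos 0<1 0≤x))
      (solve 1 (λ x → (con (+ 1) :- x :* x) :- con (+ 0) := (con (+ 1) :- x) :* (con (+ 1) :+ x)) refl x)

    height : ∃[ y ] OnUpperUnitSemicircle (x , y)
    height = semicircle-point (<⇒≤ 0<1-x²)

    y : Carrier
    y = proj₁ height

    z : Point
    z = (x , y)

    z-unit : Unit z
    z-unit = proj₁ (proj₂ height)

    0<y : 0# < y
    0<y = ≰⇒> λ y≤0 → <⇒≉ 0<1-x² (combine₂ 1# (- y) z-unit (≤-antisym y≤0 (proj₂ (proj₂ height)))
      (solve 2 (λ x y → con (+ 0) :- (con (+ 1) :- x :* x)
        := con (+ 1) :* (x :* x :+ y :* y :- con (+ 1)) :+ (:- y) :* (y :- con (+ 0))) refl x y))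

    pow : ℕ → Point
    pow zero    = one
    pow (suc d) = z ⊗ pow d

    pow-unit : ∀ d → Unit (pow d)
    pow-unit zero    = solve 0 (con (+ 1) :* con (+ 1) :+ con (+ 0) :* con (+ 0) := con (+ 1)) refl
    pow-unit (suc d) = ⊗-unit {z} z-unit (pow-unit d)

    -- As z is a unit, z² = 2xz - 1, so the imaginary parts of its powers obey the recurrence of
    -- `U`.
    pow-U : ∀ d → proj₂ (pow d) ≈ y * U d x
    pow-U zero          = sym (zeroʳ y)
    pow-U (suc zero)    = solve 2 (λ x y → x :* con (+ 0) :+ y :* con (+ 1) := y :* con (+ 1)) refl x y
    pow-U (suc (suc d)) = combine₃ (x + x) (- 1#) (- proj₂ (pow d)) (pow-U (suc d)) (pow-U d) z-unit
      (solve 6 (λ x y a b u v →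
        (x :* (x :* b :+ y :* a) :+ y :* (x :* a :- y :* b)) :- y :* ((x :+ x) :* u :- v)
        := (x :+ x) :* ((x :* b :+ y :* a) :- y :* u) :+ (:- con (+ 1)) :* (b :- y :* v)
           :+ (:- b) :* ((x :* x :+ y :* y) :- con (+ 1)))
        refl x y (proj₁ (pow d)) (proj₂ (pow d)) (U (suc d) x) (U d x))

    sine-positive : ∀ d → d ℕ.≤ suc e → 0# < proj₂ (pow (suc d))
    sine-positive d d≤ = <-respʳ-≈ (sym (pow-U (suc d))) (*-pos 0<y (positive d d≤))

    -- Squares of powers of z, rather than powers of `w`: chords and areas factor through sines of
    -- half the central angles, which `sine-positive` controls for all exponents from 1 to m - 1.
    vertex : ℕ → Point
    vertex d = square (pow d)

    w : Point
    w = square z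

    vertex-unit : ∀ d → Unit (vertex d)
    vertex-unit d = ⊗-unit {pow d} (pow-unit d) (pow-unit d)

    vertex-suc : ∀ d → vertex (suc d) ≈ₚ (w ⊗ vertex d)
    vertex-suc d = square-⊗ z (pow d)

    vertex-zero : vertex 0 ≈ₚ one
    vertex-zero = one-⊗ one

    -- The power z^m is a unit with imaginary part 0, so its square is 1 whichever sign it has.
    vertex-full : vertex m ≈ₚ one
    vertex-full = closes (pow-unit m) (trans (pow-U m) (trans (*-congˡ root) (zeroʳ y)))
      where
      closes : ∀ {u} → Unit u → proj₂ u ≈ 0# → square u ≈ₚ one
      closes {a , b} hu b≈0 =
        combine₂ 1# (- (b + b)) hu b≈0
          (solve 2 (λ a b → (a :* a :- b :* b) :- con (+ 1)
            := con (+ 1) :* (a :* a :+ b :* b :- con (+ 1)) :+ (:- (b :+ b)) :* (b :- con (+ 0))) refl a b) ,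
        combine₁ (a + a) b≈0
          (solve 2 (λ a b → (a :* b :+ b :* a) :- con (+ 0) := (a :+ a) :* (b :- con (+ 0))) refl a b)

    v : Fin m → Point
    v i = vertex (toℕ i)

    v-next : ∀ i → v (next i) ≈ₚ (w ⊗ v i)
    v-next i = ≈ₚ-trans (by-cases (ℕₚ.m≤n⇒m<n∨m≡n (Finₚ.toℕ<n i))) (vertex-suc (toℕ i))
      where
      by-cases : suc (toℕ i) ℕ.< m ⊎ suc (toℕ i) ≡ m → v (next i) ≈ₚ vertex (suc (toℕ i))
      by-cases (inj₁ i+1<m) = ≡.subst (λ a → vertex a ≈ₚ vertex (suc (toℕ i)))
        (≡.sym (≡.trans (toℕ-next i) (m<n⇒m%n≡m i+1<m))) ≈ₚ-refl
      by-cases (inj₂ i+1≡m) = ≡.subst (λ a → vertex a ≈ₚ vertex (suc (toℕ i)))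
        (≡.sym (≡.trans (toℕ-next i) (≡.trans (≡.cong (_% m) i+1≡m) (n%n≡0 m))))
        (≈ₚ-trans vertex-zero (≈ₚ-trans (≈ₚ-sym vertex-full)
          (≡.subst (λ a → vertex m ≈ₚ vertex a) (≡.sym i+1≡m) ≈ₚ-refl)))

    v-steps : ∀ d i → v (steps d i) ≈ₚ (vertex d ⊗ v i)
    v-steps zero    i = ≈ₚ-sym (≈ₚ-trans (⊗-congʳ vertex-zero) (one-⊗ (v i)))
    v-steps (suc d) i = ≈ₚ-trans (v-next (steps d i)) (≈ₚ-trans (⊗-congˡ (v-steps d i))
      (≈ₚ-trans (⊗-assoc w (vertex d) (v i)) (⊗-congʳ (≈ₚ-sym (vertex-suc d)))))

    v-unit : ∀ i → Unit (v i)
    v-unit i = vertex-unit (toℕ i)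

    -- With u = `pow (suc d)`, returning to the same vertex would force u² = 1, whereas 1 - Re u² =
    -- 2 (Im u)² is positive.
    v-moves : ∀ d i → d ℕ.≤ suc e → ¬ v i ≈ₚ v (steps (suc d) i)
    v-moves d i d≤ eq = <⇒≉ (*-pos 0<2 (*-pos (sine-positive d d≤) (sine-positive d d≤)))
      (sym (fixed (pow-unit (suc d)) (v-unit i) (≈ₚ-trans eq (v-steps (suc d) i))))
      where
      fixed : ∀ {u p} → Unit u → Unit p → p ≈ₚ (square u ⊗ p) → (1# + 1#) * (proj₂ u * proj₂ u) ≈ 0#
      fixed {a , b} {p , q} hu hp (e₁ , e₂) = ≈-by
        (+-zero (+-zero (+-zero (multiple p e₁) (multiple q e₂)) (multiple 1# hu)) (multiple (a * a - b * b - 1#) hp))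
        (solve 4 (λ a b p q →
          con (+ 2) :* (b :* b) :- con (+ 0)
          := p :* (p :- ((a :* a :- b :* b) :* p :- (a :* b :+ b :* a) :* q))
             :+ q :* (q :- ((a :* a :- b :* b) :* q :+ (a :* b :+ b :* a) :* p))
             :+ con (+ 1) :* ((a :* a :+ b :* b) :- con (+ 1))
             :+ (a :* a :- b :* b :- con (+ 1)) :* ((p :* p :+ q :* q) :- con (+ 1)))
          refl a b p q)

    v-distinct : Distinct v
    v-distinct i j eq = reached (steps-reach i j)
      where
      reached : ∃[ d ] (d ℕ.< m) × (steps d i ≡ j) → i ≡ j
      reached (zero , _ , i≡j) = i≡j
      reached (suc d , d<m , ≡.refl) = ⊥-elim (v-moves d i (ℕ.s≤s⁻¹ (ℕ.s≤s⁻¹ d<m)) eq)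

    -- Multiplication by a unit is a rotation; this moves the vertex under consideration to 1.
    cross-rotate : ∀ {a b p} → Unit p →
      cross (a ⊗ p -ₚ p) (b ⊗ p -ₚ p) ≈ cross (a -ₚ one) (b -ₚ one)
    cross-rotate {a₁ , a₂} {b₁ , b₂} {p₁ , p₂} hp =
      combine₁ (cross ((a₁ , a₂) -ₚ one) ((b₁ , b₂) -ₚ one)) hp
        (solve 6 (λ a₁ a₂ b₁ b₂ p₁ p₂ →
          ((a₁ :* p₁ :- a₂ :* p₂ :- p₁) :* (b₁ :* p₂ :+ b₂ :* p₁ :- p₂)
            :- (a₁ :* p₂ :+ a₂ :* p₁ :- p₂) :* (b₁ :* p₁ :- b₂ :* p₂ :- p₁))
            :- ((a₁ :- con (+ 1)) :* (b₂ :- con (+ 0)) :- (a₂ :- con (+ 0)) :* (b₁ :- con (+ 1)))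
          := ((a₁ :- con (+ 1)) :* (b₂ :- con (+ 0)) :- (a₂ :- con (+ 0)) :* (b₁ :- con (+ 1)))
             :* ((p₁ :* p₁ :+ p₂ :* p₂) :- con (+ 1)))
          refl a₁ a₂ b₁ b₂ p₁ p₂)

    -- For z and u at angles α and β, twice the signed area of the triangle inscribed at 0, 2α and
    -- 2(α + β) is 4 sin α sin β sin (α + β).
    cross-formula : ∀ {u} → Unit u → cross (w -ₚ one) (square (z ⊗ u) -ₚ one) ≈
      (1# + 1#) * (1# + 1#) * (y * (proj₂ (z ⊗ u) * proj₂ u))
    cross-formula {a , b} hu =
      combine₂ ((1# + 1#) * ((x * a - y * b) * (x * b + y * a))
                + (1# + 1#) * (1# + 1#) * (y * (x * b + y * a) * b))
               (- ((1# + 1#) * (x * y))) z-unit (⊗-unit {z} {a , b} z-unit hu)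
        (solve 4 (λ x y a b →
          ((x :* x :- y :* y :- con (+ 1)) :* ((x :* a :- y :* b) :* (x :* b :+ y :* a) :+ (x :* b :+ y :* a) :* (x :* a :- y :* b) :- con (+ 0))
            :- (x :* y :+ y :* x :- con (+ 0)) :* ((x :* a :- y :* b) :* (x :* a :- y :* b) :- (x :* b :+ y :* a) :* (x :* b :+ y :* a) :- con (+ 1)))
            :- con (+ 2) :* con (+ 2) :* (y :* ((x :* b :+ y :* a) :* b))
          := (con (+ 2) :* ((x :* a :- y :* b) :* (x :* b :+ y :* a)) :+ con (+ 2) :* con (+ 2) :* (y :* (x :* b :+ y :* a) :* b))
               :* ((x :* x :+ y :* y) :- con (+ 1))
             :+ (:- (con (+ 2) :* (x :* y)))
               :* (((x :* a :- y :* b) :* (x :* a :- y :* b) :+ (x :* b :+ y :* a) :* (x :* b :+ y :* a)) :- con (+ 1)))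
          refl x y a b)

    v-convex : ∀ i j → j ≢ i → j ≢ next i → 0# < cross (v (next i) -ₚ v i) (v j -ₚ v i)
    v-convex i j j≢i j≢next = reached (steps-reach i j)
      where
      reached : ∃[ d ] (d ℕ.< m) × (steps d i ≡ j) → 0# < cross (v (next i) -ₚ v i) (v j -ₚ v i)
      reached (zero , _ , i≡j) = ⊥-elim (j≢i (≡.sym i≡j))
      reached (suc zero , _ , next≡j) = ⊥-elim (j≢next (≡.sym next≡j))
      reached (suc (suc d) , d<m , ≡.refl) = <-respʳ-≈ (sym area)
        (*-pos (*-pos 0<2 0<2) (*-pos 0<y (*-pos
          (sine-positive (suc d) (ℕ.s≤s⁻¹ (ℕ.s≤s⁻¹ d<m)))
          (sine-positive d (ℕₚ.≤-trans (ℕₚ.n≤1+n d) (ℕ.s≤s⁻¹ (ℕ.s≤s⁻¹ d<m)))))))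
        where
        area : cross (v (next i) -ₚ v i) (v (steps (2 ℕ.+ d) i) -ₚ v i) ≈
               (1# + 1#) * (1# + 1#) * (y * (proj₂ (pow (2 ℕ.+ d)) * proj₂ (pow (suc d))))
        area = trans (cross-cong (-ₚ-cong (v-next i) ≈ₚ-refl) (-ₚ-cong (v-steps (2 ℕ.+ d) i) ≈ₚ-refl))
          (trans (cross-rotate {w} {vertex (2 ℕ.+ d)} {v i} (v-unit i)) (cross-formula {pow (suc d)} (pow-unit (suc d))))

    side² : ∀ i → (v (next i) -ₚ v i) · (v (next i) -ₚ v i) ≈ (w -ₚ one) · (w -ₚ one)
    side² i = trans (·-cong side-cong side-cong) (rotated w (v i) (v-unit i))
      where
      side-cong : (v (next i) -ₚ v i) ≈ₚ (w ⊗ v i -ₚ v i)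
      side-cong = -ₚ-cong (v-next i) ≈ₚ-refl
      rotated : ∀ a p → Unit p → (a ⊗ p -ₚ p) · (a ⊗ p -ₚ p) ≈ (a -ₚ one) · (a -ₚ one)
      rotated (a₁ , a₂) (p₁ , p₂) hp = combine₁ (((a₁ , a₂) -ₚ one) · ((a₁ , a₂) -ₚ one)) hp
        (solve 4 (λ a₁ a₂ p₁ p₂ →
          ((a₁ :* p₁ :- a₂ :* p₂ :- p₁) :* (a₁ :* p₁ :- a₂ :* p₂ :- p₁)
            :+ (a₁ :* p₂ :+ a₂ :* p₁ :- p₂) :* (a₁ :* p₂ :+ a₂ :* p₁ :- p₂))
            :- ((a₁ :- con (+ 1)) :* (a₁ :- con (+ 1)) :+ (a₂ :- con (+ 0)) :* (a₂ :- con (+ 0)))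
          := ((a₁ :- con (+ 1)) :* (a₁ :- con (+ 1)) :+ (a₂ :- con (+ 0)) :* (a₂ :- con (+ 0)))
             :* ((p₁ :* p₁ :+ p₂ :* p₂) :- con (+ 1)))
          refl a₁ a₂ p₁ p₂)

    corner : ∀ i → (v i -ₚ v (next i)) · (v (next (next i)) -ₚ v (next i)) ≈
                   (one -ₚ w) · (w ⊗ w -ₚ w)
    corner i = trans (·-cong (-ₚ-cong ≈ₚ-refl (v-next i))
        (-ₚ-cong (≈ₚ-trans (v-next (next i)) (⊗-congˡ (v-next i))) (v-next i)))
      (rotated w (v i) (v-unit i))
      where
      rotated : ∀ a p → Unit p → (p -ₚ a ⊗ p) · (a ⊗ (a ⊗ p) -ₚ a ⊗ p) ≈ (one -ₚ a) · (a ⊗ a -ₚ a)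
      rotated (a₁ , a₂) (p₁ , p₂) hp = combine₁ ((one -ₚ (a₁ , a₂)) · ((a₁ , a₂) ⊗ (a₁ , a₂) -ₚ (a₁ , a₂))) hp
        (solve 4 (λ a b p q →
          ((p :- (a :* p :- b :* q)) :* ((a :* (a :* p :- b :* q) :- b :* (a :* q :+ b :* p)) :- (a :* p :- b :* q))
            :+ (q :- (a :* q :+ b :* p)) :* ((a :* (a :* q :+ b :* p) :+ b :* (a :* p :- b :* q)) :- (a :* q :+ b :* p)))
            :- ((con (+ 1) :- a) :* ((a :* a :- b :* b) :- a) :+ (con (+ 0) :- b) :* ((a :* b :+ b :* a) :- b))
          := ((con (+ 1) :- a) :* ((a :* a :- b :* b) :- a) :+ (con (+ 0) :- b) :* ((a :* b :+ b :* a) :- b))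
             :* ((p :* p :+ q :* q) :- con (+ 1)))
          refl a₁ a₂ p₁ p₂)

    open Circle origin 1# 0<1

    -- One corner serves for all: by `side²` and `corner` the norms and the product of the two edge
    -- vectors do not depend on the corner, so neither does the cosine.
    first-angle : InscribedAngle (v Fin.zero) (v (next Fin.zero)) (v (next (next Fin.zero)))
    first-angle = inscribed-angle (on Fin.zero) (on (next Fin.zero)) (on (next (next Fin.zero)))
      (v-moves 0 Fin.zero ℕ.z≤n)
      (λ eq → v-moves 0 (next Fin.zero) ℕ.z≤n (≈ₚ-sym eq))
      (λ eq → v-moves 1 Fin.zero (ℕ.s≤s ℕ.z≤n) (≈ₚ-sym eq))
      where
      on : ∀ i → IsDistance origin (v i) 1#
      on i = on-unit-circle (v-unit i)

    regular : IsRegularPolygon v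
    regular = record
      { atLeast3    = ℕ.s≤s (ℕ.s≤s (ℕ.s≤s ℕ.z≤n))
      ; convex      = v-convex
      ; equilateral = proj₁ side , λ i → proj₁ (proj₂ side) , trans (proj₂ (proj₂ side)) (sym (side² i))
      ; equiangular = First.θ , λ i → First.c , cosine i , First.arccos }
      where
      module First = InscribedAngle first-angle
      side : ∃ (IsNorm (w -ₚ one))
      side = norm (w -ₚ one)
      cosine : ∀ i → IsCosine (v i -ₚ v (next i)) (v (next (next i)) -ₚ v (next i)) First.c
      cosine i = cosine-transfer
        (trans (dist²-sym (v (next Fin.zero)) (v Fin.zero)) (trans (side² Fin.zero) (trans (sym (side² i)) (dist²-sym (v i) (v (next i))))))
        (trans (side² (next Fin.zero)) (sym (side² (next i))))
        (trans (corner Fin.zero) (sym (corner i)))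
        First.cosine

  -- Adding further points on the circle.

  record Configuration (n m : ℕ) : Set where
    field
      P        : Fin n → Point
      distinct : Distinct P
      unit     : ∀ i → Unit (P i)
      ι        : Fin m → Fin n
      regular  : IsRegularPolygon (λ i → P (ι i))

  half : ∃[ h ] (0# < h) × (h < 1#)
  half = proj₁ h , proj₂ (proj₂ h) ,
    <-by (proj₂ (proj₂ h)) (combine₁ (- 1#) (proj₁ (proj₂ h))
      (solve 1 (λ h → (con (+ 1) :- h) :- h := (:- con (+ 1)) :* (con (+ 2) :* h :- con (+ 1))) refl (proj₁ h)))
    where
    h : ∃[ h ] ((1# + 1#) * h ≈ 1#) × (0# < h)
    h = pos-inverse 0<2

  -- If the new value is at most h then multiplying h by it goes below both,
  -- since both are less than 1.
  below-all : ∀ {n} (a : Fin n → Carrier) → ∃[ h ] (0# < h) × (h < 1#) × (∀ i → 0# < a i → h < a i)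
  below-all {zero}  a = proj₁ half , proj₁ (proj₂ half) , proj₂ (proj₂ half) , λ ()
  below-all {suc n} a = decide (below-all (λ i → a (Fin.suc i)))
    where
    a₀ : Carrier
    a₀ = a Fin.zero

    keep : ∀ {h} → (0# < a₀ → h < a₀) → (∀ i → 0# < a (Fin.suc i) → h < a (Fin.suc i)) → ∀ i → 0# < a i → h < a i
    keep h<a₀ h<a Fin.zero    = h<a₀
    keep h<a₀ h<a (Fin.suc i) = h<a i

    decide : ∃[ h ] (0# < h) × (h < 1#) × (∀ i → 0# < a (Fin.suc i) → h < a (Fin.suc i)) →
             ∃[ h ] (0# < h) × (h < 1#) × (∀ i → 0# < a i → h < a i)
    decide (h , 0<h , h<1 , h<a) with 0# <? a₀ | h <? a₀
    ... | no a₀≯0 | _       = h , 0<h , h<1 , keep (λ 0<a₀ → ⊥-elim (a₀≯0 0<a₀)) h<a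
    ... | yes _ | yes h<a₀  = h , 0<h , h<1 , keep (λ _ → h<a₀) h<a
    ... | yes 0<a₀ | no h≮a₀ = h * a₀ , *-pos 0<h 0<a₀ , <-trans ha₀<h h<1 ,
          keep (λ _ → ha₀<a₀) (λ i 0<a → <-trans ha₀<h (h<a i 0<a))
      where
      ha₀<h : h * a₀ < h
      ha₀<h = <-by (*-pos 0<h (pos (≤-<-trans (≮⇒≥ h≮a₀) h<1)))
        (solve 2 (λ h b → h :- h :* b := h :* (con (+ 1) :- b)) refl h a₀)
      ha₀<a₀ : h * a₀ < a₀
      ha₀<a₀ = <-by (*-pos 0<a₀ (pos h<1))
        (solve 2 (λ h b → b :- h :* b := b :* (con (+ 1) :- h)) refl h a₀)

  module AddPoint {n m} (C : Configuration n m) where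
    open Configuration C

    fresh : ∃[ h ] (0# < h) × (h < 1#) × (∀ i → 0# < proj₁ (P i) → h < proj₁ (P i))
    fresh = below-all (λ i → proj₁ (P i))

    h : Carrier
    h = proj₁ fresh

    0≤1-h² : 0# ≤ 1# - h * h
    0≤1-h² = <⇒≤ (<-by (*-pos (pos (proj₁ (proj₂ (proj₂ fresh)))) (+-pos 0<1 (<⇒≤ (proj₁ (proj₂ fresh)))))
      (solve 1 (λ x → (con (+ 1) :- x :* x) :- con (+ 0) := (con (+ 1) :- x) :* (con (+ 1) :+ x)) refl h))

    new : Point
    new = h , proj₁ (semicircle-point 0≤1-h²)

    -- A point sharing the abscissa `h` would have a positive abscissa, and `h` is strictly below
    -- all of those.
    new-apart : ∀ i → ¬ new ≈ₚ P i
    new-apart i (h≈a , _) = <⇒≉ (proj₂ (proj₂ (proj₂ fresh)) i (<-respʳ-≈ h≈a (proj₁ (proj₂ fresh)))) h≈a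

    P′ : Fin (suc n) → Point
    P′ Fin.zero    = new
    P′ (Fin.suc i) = P i

    distinct′ : Distinct P′
    distinct′ Fin.zero    Fin.zero    _  = ≡.refl
    distinct′ Fin.zero    (Fin.suc j) eq = ⊥-elim (new-apart j eq)
    distinct′ (Fin.suc i) Fin.zero    eq = ⊥-elim (new-apart i (≈ₚ-sym eq))
    distinct′ (Fin.suc i) (Fin.suc j) eq = ≡.cong Fin.suc (distinct i j eq)

    unit′ : ∀ i → Unit (P′ i)
    unit′ Fin.zero    = proj₁ (proj₂ (semicircle-point 0≤1-h²))
    unit′ (Fin.suc i) = unit i

    extended : Configuration (suc n) m
    extended = record { P = P′ ; distinct = distinct′ ; unit = unit′ ; ι = λ i → Fin.suc (ι i) ; regular = regular }

  configuration : ∀ k e → Configuration (k ℕ.+ (3 ℕ.+ e)) (3 ℕ.+ e)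
  configuration zero    e = record
    { P = v ; distinct = v-distinct ; unit = v-unit ; ι = λ i → i ; regular = regular }
    where open Polygon e
  configuration (suc k) e = AddPoint.extended (configuration k e)

  𝒮-inhabited : ∀ n k → k ℕ.+ 3 ℕ.≤ n → ∃ (𝒮 n k)
  𝒮-inhabited n k k+3≤n = build n (n ∸ k) (n ∸ k ∸ 3) (ℕₚ.m+[n∸m]≡n k≤n) (≡.sym (ℕₚ.m+[n∸m]≡n 3≤n∸k)) ≡.refl
    where
    k≤n : k ℕ.≤ n
    k≤n = ℕₚ.≤-trans (ℕₚ.m≤m+n k 3) k+3≤n
    3≤n∸k : 3 ℕ.≤ n ∸ k
    3≤n∸k = ≡.subst (ℕ._≤ n ∸ k) (ℕₚ.m+n∸m≡n k 3) (ℕₚ.∸-monoˡ-≤ k k+3≤n)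

    -- With `n` and `m` as variables, the first two equations can be matched, giving them the shape
    -- of `configuration`; the third transports the polygon to `Fin (n ∸ k)`.
    build : ∀ n m e → k ℕ.+ m ≡ n → m ≡ 3 ℕ.+ e → m ≡ n ∸ k → ∃ (𝒮 n k)
    build n m e ≡.refl ≡.refl eq = P , record
      { distinct = distinct
      ; onCircle = origin , 1# , 0<1 , λ i → on-unit-circle (unit i)
      ; polygon  = ≡.subst (λ m → Σ (Fin m → Fin n) λ ι → IsRegularPolygon (λ i → P (ι i))) eq (ι , regular) }
      where open Configuration (configuration k e)

-- The maximum and its order of growth.

open import Data.Nat.Base using (_+_; _*_; _≤_)

-- Descent from the bound: excluded middle decides whether `B` itself is attained, and if not the
-- bound drops by one.
bounded-max : ExcludedMiddle 0ℓ → (Q : ℕ → Set) → ∀ B → ∃ Q → (∀ N → Q N → N ≤ B) →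
  ∃[ N ] Q N × (∀ M → Q M → M ≤ N)
bounded-max em Q zero (N , QN) bound = N , QN , λ M QM → ℕₚ.≤-trans (bound M QM) ℕ.z≤n
bounded-max em Q (suc B) inhabited bound with em {P = Q (suc B)}
... | yes QB = suc B , QB , bound
... | no ¬QB = bounded-max em Q B inhabited λ N QN → ℕ.s≤s⁻¹
  (ℕₚ.≤∧≢⇒< (bound N QN) (λ { ≡.refl → ¬QB QN }))

module MaxAngleCount (em : ExcludedMiddle 0ℓ) (ℝ : CompleteOrderedField) (k : ℕ) (1≤k : 1 ≤ k) where
  open Plane ℝ
  open Cardinality em ℝ
  open AngleBounds em ℝ
  open PolygonExistence ℝ using (𝒮-inhabited)

  module _ {n} (k+3≤n : k + 3 ≤ n) where
    k≤n : k ≤ n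
    k≤n = ℕₚ.≤-trans (ℕₚ.m≤m+n k 3) k+3≤n

    count-bounded : ∀ {P : Fin n → Point} {N} → 𝒮 n k P → AngleCount P N → N ≤ 4 * (n * k)
    count-bounded S count = ℕₚ.≤-trans
      (cardinality-bounded count (proj₁ listing) (proj₂ (proj₂ listing))) (proj₁ (proj₂ listing))
      where
      listing = UpperBound.angles S k≤n 1≤k

    count-exists : ∀ {P : Fin n → Point} → 𝒮 n k P → ∃ (AngleCount P)
    count-exists S = proj₁ counted , proj₂ (proj₂ counted)
      where
      listing = UpperBound.angles S k≤n 1≤k
      counted = cardinality-exists _ determinesAngle-resp (proj₁ listing) (proj₂ (proj₂ listing))

    maximum : ∃ (IsMaxAngleCount n k)
    maximum = proj₁ max , proj₁ (proj₂ max) , λ P S M count → proj₂ (proj₂ max) M (P , S , count)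
      where
      some : ∃ (𝒮 n k)
      some = 𝒮-inhabited n k k+3≤n
      max : ∃[ N ] (Σ (Fin n → Point) λ P → 𝒮 n k P × AngleCount P N) ×
                   (∀ M → (Σ (Fin n → Point) λ P → 𝒮 n k P × AngleCount P M) → M ≤ N)
      max = bounded-max em (λ N → Σ (Fin n → Point) λ P → 𝒮 n k P × AngleCount P N) (4 * (n * k))
        (proj₁ (count-exists (proj₂ some)) , proj₁ some , proj₂ some , proj₂ (count-exists (proj₂ some)))
        (λ N (P , S , count) → count-bounded S count)

  many-angles : ∀ {n} {P : Fin n → Point} {N} → 3 ≤ n → 𝒮 n k P → AngleCount P N → n ≤ 3 * N
  many-angles (ℕ.s≤s (ℕ.s≤s (ℕ.s≤s _))) S count = LowerBound.many-angles (𝒮.distinct S) (𝒮.onCircle S) count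

  choose : ∀ n → ∃[ N ] (k + 3 ≤ n → IsMaxAngleCount n k N)
  choose n with k + 3 ℕₚ.≤? n
  ... | yes large = proj₁ (maximum large) , λ _ → proj₂ (maximum large)
  -- For `n` below `k + 3` fewer than 3 vertices remain and the family is empty; 0 is a default
  -- value outside the asymptotic range.
  ... | no small  = 0 , λ large → ⊥-elim (small large)

  maxA : ℕ → ℕ
  maxA n = proj₁ (choose n)

  maxA-isMax : ∀ n → k + 3 ≤ n → IsMaxAngleCount n k (maxA n)
  maxA-isMax n = proj₂ (choose n)

  maxA-upper : ∀ n → k + 3 ≤ n → maxA n ≤ 4 * (n * k)
  maxA-upper n large = attained (proj₁ (maxA-isMax n large))
    where
    attained : (Σ (Fin n → Point) λ P → 𝒮 n k P × AngleCount P (maxA n)) → maxA n ≤ 4 * (n * k)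
    attained (P , S , count) = count-bounded large S count

  -- The bound `n ≤ 3 * maxA n` holds for every configuration in the family, in particular for a
  -- maximal one; multiplying by the fixed `k` gives the constant.
  maxA-lower : ∀ n → k + 3 ≤ n → n * k ≤ 3 * k * maxA n
  maxA-lower n large = attained (proj₁ (maxA-isMax n large))
    where
    module N = +-*-Solver
    attained : (Σ (Fin n → Point) λ P → 𝒮 n k P × AngleCount P (maxA n)) → n * k ≤ 3 * k * maxA n
    attained (P , S , count) = ℕₚ.≤-trans
      (ℕₚ.*-monoˡ-≤ k (many-angles (ℕₚ.≤-trans (ℕₚ.m≤n+m 3 k) large) S count))
      (ℕₚ.≤-reflexive (N.solve 2 (λ a k → N.con 3 N.:* a N.:* k N.:= N.con 3 N.:* k N.:* a) ≡.refl (maxA n) k))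

proposition3p2 : ExcludedMiddle 0ℓ →
    (ℝ : CompleteOrderedField) →
    (k : ℕ) → 1 ≤ k →
    Σ (ℕ → ℕ) λ maxA →
    (∀ n → k + 3 ≤ n → Plane.IsMaxAngleCount ℝ n k (maxA n)) ×
    (maxA ∈Θ (λ n → n * k))
proposition3p2 em ℝ k 1≤k = maxA , maxA-isMax , (4 , k + 3 , maxA-upper) , (3 * k , k + 3 , maxA-lower)
  where open MaxAngleCount em ℝ k 1≤k
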